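{- The problem INDEPENDENT CUTSET can be solved in $\mathcal{O}^*(3^{n/3})$ time, where $n$ is the number of vertices of the input graph.
   Context: All graphs are finite, simple, loopless and undirected. A set $S$ of vertices of a graph $G$ is a cutset of $G$ if $G-S$ is disconnected; it is an independent set if its vertices are pairwise nonadjacent. An independent cutset of $G$ is a set of vertices that is both a cutset and an independent set of $G$. INDEPENDENT CUTSET is the decision problem: given a connected graph $G$, does $G$ have an independent cutset? The notation $\mathcal{O}^*$ is the $\mathcal{O}$-notation with factors polynomial in the input size suppressed. -}

module Defs where

open import Data.Bool.Base using (if_then_else_)
open import Data.Fin.Base using (Fin)
open import Data.Fin.Subset using (Subset; _∈_; _∉_)
open import Data.List.Base using (List; []; _∷_; length; concat; tabulate)
open import Data.Nat.Base using (ℕ; zero; suc; pred; _+_; _*_; _^_; _≤_; _≡ᵇ_; NonZero)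
open import Data.Product.Base using (∃₂; ∃-syntax; _×_)
open import Function.Bundles using (_⇔_)
open import Relation.Binary.Construct.Closure.ReflexiveTransitive using (Star)
open import Relation.Binary.Core using (Rel)
open import Relation.Binary.Definitions using (Decidable; Symmetric; Irreflexive)
open import Relation.Binary.PropositionalEquality.Core using (_≡_; _≢_)
open import Relation.Nullary using (¬_; does)
open import Level using (0ℓ)

------------------------------------------------------------------------
-- Graphs

record Graph (n : ℕ) : Set₁ where
  field
    Adj    : Rel (Fin n) 0ℓ
    adj?   : Decidable Adj
    sym    : Symmetric Adj
    irrefl : Irreflexive _≡_ Adj

open Graph public using (Adj; adj?)

module _ {n : ℕ} (G : Graph n) where

  -- Adjacency in G − S, on the vertex type of G.
  AdjAvoiding : Subset n → Rel (Fin n) 0ℓ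
  AdjAvoiding S u v = u ∉ S × v ∉ S × Adj G u v

  -- G − S is connected.  This holds vacuously if S is the whole vertex set, so
  -- the whole vertex set is never a cutset.
  ConnectedAvoiding : Subset n → Set
  ConnectedAvoiding S = ∀ {u v} → u ∉ S → v ∉ S → Star (AdjAvoiding S) u v

  Connected : Set
  Connected = ∀ u v → Star (Adj G) u v

  IsCutset : Subset n → Set
  IsCutset S = ¬ ConnectedAvoiding S

  IsIndependent : Subset n → Set
  IsIndependent S = ∀ {u v} → u ∈ S → v ∈ S → ¬ Adj G u v

  HasIndependentCutset : Set
  HasIndependentCutset = ∃[ S ] (IsCutset S × IsIndependent S)

------------------------------------------------------------------------
-- Random access machines
--
-- Running times are measured on a random access machine with registers, an
-- indirectly addressed memory, and structured control flow.  Its only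
-- arithmetic is successor and predecessor, so after t steps every number is at
-- most t plus a constant (depending on the program) plus the largest input
-- number.  Unit cost per step is therefore a realistic measure: no computation
-- can be hidden in operations on huge numbers.

Register : Set
Register = ℕ

infixr 5 _⨾_
infix  6 _≔#_ _≔_ _≔suc_ _≔pred_ _≔mem[_] mem[_]≔_

data Program : Set where
  _≔#_ : Register → ℕ → Program
  _≔_ : Register → Register → Program
  _≔suc_ : Register → Register → Program
  _≔pred_ : Register → Register → Program
  _≔mem[_] : Register → Register → Program
  mem[_]≔_ : Register → Register → Program
  _⨾_ : Program → Program → Program
  ifZero_then_else_ : Register → Program → Program → Program
  whileNonZero_loop_ : Register → Program → Program

record State : Set where
  constructor ⟨_,_⟩
  field
    reg : Register → ℕ
    mem : ℕ → ℕ

open State public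

_[_↦_] : (ℕ → ℕ) → ℕ → ℕ → (ℕ → ℕ)
(f [ i ↦ x ]) j = if i ≡ᵇ j then x else f j

-- P ⊢ s ⇓ s′ after t : started in state s, P halts in state s′ after t steps,
-- where every assignment and every test of a register is one step.
infix 4 _⊢_⇓_after_

data _⊢_⇓_after_ : Program → State → State → ℕ → Set where

  const : ∀ {i k r m} →
    i ≔# k ⊢ ⟨ r , m ⟩ ⇓ ⟨ r [ i ↦ k ] , m ⟩ after 1

  copy : ∀ {i j r m} →
    i ≔ j ⊢ ⟨ r , m ⟩ ⇓ ⟨ r [ i ↦ r j ] , m ⟩ after 1

  succ : ∀ {i j r m} →
    i ≔suc j ⊢ ⟨ r , m ⟩ ⇓ ⟨ r [ i ↦ suc (r j) ] , m ⟩ after 1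

  prec : ∀ {i j r m} →
    i ≔pred j ⊢ ⟨ r , m ⟩ ⇓ ⟨ r [ i ↦ pred (r j) ] , m ⟩ after 1

  load : ∀ {i j r m} →
    i ≔mem[ j ] ⊢ ⟨ r , m ⟩ ⇓ ⟨ r [ i ↦ m (r j) ] , m ⟩ after 1

  store : ∀ {i j r m} →
    mem[ i ]≔ j ⊢ ⟨ r , m ⟩ ⇓ ⟨ r , m [ r i ↦ r j ] ⟩ after 1

  seq : ∀ {P Q s s′ s″ t t′} →
    P ⊢ s ⇓ s′ after t →
    Q ⊢ s′ ⇓ s″ after t′ →
    P ⨾ Q ⊢ s ⇓ s″ after (t + t′)

  if-zero : ∀ {i P Q s s′ t} →
    reg s i ≡ 0 →
    P ⊢ s ⇓ s′ after t →
    ifZero i then P else Q ⊢ s ⇓ s′ after suc t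

  if-nonzero : ∀ {i P Q s s′ t} →
    reg s i ≢ 0 →
    Q ⊢ s ⇓ s′ after t →
    ifZero i then P else Q ⊢ s ⇓ s′ after suc t

  while-stop : ∀ {i P s} →
    reg s i ≡ 0 →
    whileNonZero i loop P ⊢ s ⇓ s after 1

  while-step : ∀ {i P s s′ s″ t t′} →
    reg s i ≢ 0 →
    P ⊢ s ⇓ s′ after t →
    whileNonZero i loop P ⊢ s′ ⇓ s″ after t′ →
    whileNonZero i loop P ⊢ s ⇓ s″ after suc (t + t′)

contents : List ℕ → ℕ → ℕ
contents []       _       = 0
contents (x ∷ _)  zero    = x
contents (_ ∷ xs) (suc i) = contents xs i

-- The input word is stored from address 0 on; everything else is 0.
initial : List ℕ → State
initial w = ⟨ (λ _ → 0) , contents w ⟩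

Accepting : State → Set
Accepting s = reg s 0 ≡ 1

------------------------------------------------------------------------
-- Decision problems and O*

record DecisionProblem : Set₂ where
  field
    Instance : Set₁
    encode   : Instance → List ℕ
    Yes      : Instance → Set

  size : Instance → ℕ
  size I = length (encode I)

-- Π SolvableInO*[ b ^ μ / q ] : Π can be solved in O*(b^(μ/q)) time, for a
-- parameter μ of the instances.  The time bound t ≤ b^(μ/q) · c · (1 + size)^k
-- has a real exponent and is therefore stated with both sides raised to the
-- power q.
_SolvableInO*[_^_/_] : (Π : DecisionProblem) → ℕ →
                       (DecisionProblem.Instance Π → ℕ) →
                       (q : ℕ) → .{{NonZero q}} → Set₁
Π SolvableInO*[ b ^ μ / q ] =
  ∃[ P ] ∃[ c ] ∃[ k ] ∀ (I : Instance) → ∃₂ λ s t →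
    P ⊢ initial (encode I) ⇓ s after t ×
    (Accepting s ⇔ Yes I) ×
    t ^ q ≤ b ^ μ I * (c * suc (size I) ^ k) ^ q
  where open DecisionProblem Π

record ConnectedGraph : Set₁ where
  field
    order     : ℕ
    graph     : Graph order
    connected : Connected graph

open ConnectedGraph public using (order; graph)

-- The number of vertices followed by the adjacency matrix, row by row.
encodeGraph : ∀ {n} → Graph n → List ℕ
encodeGraph {n} G =
  n ∷ concat (tabulate λ u → tabulate λ v → if does (adj? G u v) then 1 else 0)

INDEPENDENT-CUTSET : DecisionProblem
INDEPENDENT-CUTSET = record
  { Instance = ConnectedGraph
  ; encode   = λ I → encodeGraph (graph I)
  ; Yes      = λ I → HasIndependentCutset (graph I)
  }

{-# OPTIONS --safe #-}
module Submission where

-- In a connected graph an independent superset S′ of an independent cutset S is a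
-- cutset: a vertex of S′ − S has a neighbour, which is outside S′.  So it suffices to
-- test one independent set above each independent cutset.  These are found by
-- branching: take an undecided vertex v of minimum degree d in the graph induced by
-- the undecided vertices, and choose one of the d + 1 undecided vertices in the closed
-- neighbourhood of v, thereby excluding its neighbours.  An independent set M that
-- avoids all excluded vertices still does so in some branch: for a vertex of M in the
-- closed neighbourhood of v, or for v if there is none.  Each branch decides at least
-- d + 1 vertices, and k³ ≤ 3^k, so the number ℓ of leaves satisfies ℓ³ ≤ 3^n.

open import Data.Bool.Base using (Bool; true; false; T; _∨_; if_then_else_)
open import Data.Fin.Base as Fin using (Fin; toℕ; fromℕ<)
open import Data.Fin.Properties using (toℕ<n; toℕ-fromℕ<; toℕ-injective; any?)
import Data.Fin.Properties as Fin
open import Data.Fin.Subset using (Subset; _∈_; _∉_; _⊆_)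
open import Data.Fin.Subset.Properties using (_∈?_)
open import Data.List.Base using (List; []; _∷_; length; foldr; concat; tabulate; _++_)
import Data.List.Membership.Propositional as List
open import Data.List.Properties using (length-tabulate; length-++)
open import Data.List.Relation.Unary.All as All using (All; []; _∷_)
open import Data.List.Relation.Unary.Any using (here; there)
open import Data.Nat.Base
open import Data.Nat.Properties
open import Data.Nat.Tactic.RingSolver using (solve-∀)
open import Data.Product.Base using (_×_; _,_; Σ; ∃; ∃₂; proj₁; proj₂)
open import Data.Sum.Base using (_⊎_; inj₁; inj₂; map₁; [_,_]′)
open import Data.Unit.Base using (⊤; tt)
import Data.Vec.Base as Vec
open import Data.Vec.Properties using (lookup∘tabulate; lookup⇒[]=; []=⇒lookup)
open import Function.Base using (_∘_; id)
open import Function.Bundles using (_⇔_; mk⇔)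
open import Relation.Binary.Construct.Closure.ReflexiveTransitive as Star
  using (Star; ε; _◅_; _◅◅_)
open import Relation.Binary.PropositionalEquality hiding (J)
open import Relation.Nullary using (¬_; yes; no; does; contradiction)
open import Relation.Nullary.Decidable using (dec-true; dec-false; decidable-stable; _×-dec_)
open import Defs

-- The constant comes from the recurrence ℓ(r) ≤ (d + 1) · ℓ(r - (d + 1)) in the number r of
-- undecided vertices: minimality of d makes each of the d + 1 choices decide at least d + 1
-- vertices, and k^(1/k) is largest over the integers at k = 3. Disjoint triangles attain it. A
-- vertex is excluded only when it has a chosen neighbour, so the chosen set at a leaf is a maximal
-- independent set; that one set may occur at several leaves harms neither correctness nor the
-- bound. The obstacle is that time is measured on a machine that can only count up and down and has
-- no recursion. The search is therefore a single loop over an explicit stack of configurations.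
-- Every other loop runs at most `N` times, so the time of one pass through the search loop is read
-- off the syntax and is polynomial; only the passes need a combinatorial count. As each branching
-- decides a vertex, a tree has at most n + 1 nodes per leaf, which adds one more polynomial factor.

-- An upper bound for the running time when every loop is iterated at most N times.
cost : ℕ → Program → ℕ
cost N (P ⨾ Q)                    = cost N P + cost N Q
cost N (ifZero _ then P else Q)   = suc (cost N P + cost N Q)
cost N (whileNonZero _ loop P)    = suc (N * suc (cost N P))
cost N _                          = 1

-- Only positive arguments are considered, because enlarging the exponent preserves a bound only
-- over a nonzero base; this is what allows bounds with different exponents to be added. The
-- argument `suc M` later becomes the `suc (size I)` of the time bound.
record PolyBounded (f : ℕ → ℕ) : Set where
  constructor poly
  field
    {coefficient exponent} : ℕ
    bound : ∀ M → f (suc M) ≤ coefficient * suc M ^ exponent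

poly-const : ∀ b → PolyBounded (λ _ → b)
poly-const b = poly {coefficient = b} {0} λ M → ≤-reflexive (sym (*-identityʳ b))

poly-id : PolyBounded (λ N → N)
poly-id = poly {coefficient = 1} {1} λ M → ≤-reflexive (sym (trans (*-identityˡ _) (*-identityʳ _)))

poly-+ : ∀ {f g} → PolyBounded f → PolyBounded g → PolyBounded (λ N → f N + g N)
poly-+ {f} {g} (poly {a} {j} p) (poly {b} {k} q) =
  poly {coefficient = a + b} {j + k} λ M → let N = suc M in begin
  f N + g N                             ≤⟨ +-mono-≤ (p M) (q M) ⟩
  a * N ^ j + b * N ^ k                 ≤⟨ +-mono-≤ (*-monoʳ-≤ a (^-monoʳ-≤ N (m≤m+n j k)))
                                                    (*-monoʳ-≤ b (^-monoʳ-≤ N (m≤n+m k j))) ⟩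
  a * N ^ (j + k) + b * N ^ (j + k)     ≡⟨ *-distribʳ-+ (N ^ (j + k)) a b ⟨
  (a + b) * N ^ (j + k)                 ∎
  where open ≤-Reasoning

poly-suc : ∀ {f} → PolyBounded f → PolyBounded (λ N → suc (f N))
poly-suc = poly-+ (poly-const 1)

poly-* : ∀ {f g} → PolyBounded f → PolyBounded g → PolyBounded (λ N → f N * g N)
poly-* {f} {g} (poly {a} {j} p) (poly {b} {k} q) =
  poly {coefficient = a * b} {j + k} λ M → let N = suc M in begin
  f N * g N                       ≤⟨ *-mono-≤ (p M) (q M) ⟩
  (a * N ^ j) * (b * N ^ k)       ≡⟨ lemma a b (N ^ j) (N ^ k) ⟩
  a * b * (N ^ j * N ^ k)         ≡⟨ cong (a * b *_) (^-distribˡ-+-* N j k) ⟨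
  a * b * N ^ (j + k)             ∎
  where
  open ≤-Reasoning
  lemma : ∀ a b x y → (a * x) * (b * y) ≡ a * b * (x * y)
  lemma = solve-∀

cost-poly : ∀ P → PolyBounded (λ N → cost N P)
cost-poly (_ ≔# _)                  = poly-const 1
cost-poly (_ ≔ _)                   = poly-const 1
cost-poly (_ ≔suc _)                = poly-const 1
cost-poly (_ ≔pred _)               = poly-const 1
cost-poly (_ ≔mem[ _ ])             = poly-const 1
cost-poly (mem[ _ ]≔ _)             = poly-const 1
cost-poly (P ⨾ Q)                   = poly-+ (cost-poly P) (cost-poly Q)
cost-poly (ifZero _ then P else Q)  = poly-suc (poly-+ (cost-poly P) (cost-poly Q))
cost-poly (whileNonZero _ loop P)   = poly-suc (poly-* poly-id (poly-suc (cost-poly P)))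

-- Total correctness with syntactic time bounds

times : Register → Program → Program
-- The counter is lowered before `P` runs, so `P` sees the values k - 1, ..., 0 and can use the
-- counter as a vertex index.
times c P = whileNonZero c loop (c ≔pred c ⨾ P)

update-same : ∀ (f : ℕ → ℕ) i x → (f [ i ↦ x ]) i ≡ x
update-same f zero    x = refl
update-same f (suc i) x = update-same (λ j → f (suc j)) i x

update-other : ∀ (f : ℕ → ℕ) {i j} x → i ≢ j → (f [ i ↦ x ]) j ≡ f j
update-other f {zero}  {zero}  x i≢j with () ← i≢j refl
update-other f {zero}  {suc j} x i≢j = refl
update-other f {suc i} {zero}  x i≢j = refl
update-other f {suc i} {suc j} x i≢j = update-other (λ k → f (suc k)) x (λ p → i≢j (cong suc p))

module Logic (N : ℕ) where

  -- The time is bounded by the syntactic `cost` alone, so the rules for composite programs combine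
  -- the bounds once and for all, and specifications speak only of states.
  record Run (P : Program) (s : State) (Q : State → Set) : Set where
    constructor ran
    field
      {final} : State
      {time}  : ℕ
      exec    : P ⊢ s ⇓ final after time
      time≤   : time ≤ cost N P
      post    : Q final

  weaken : ∀ {P s Q R} → (∀ {s′} → Q s′ → R s′) → Run P s Q → Run P s R
  weaken f (ran e t q) = ran e t (f q)

  infixr 5 _>>_
  _>>_ : ∀ {P P′ s Q R} → Run P s Q → (∀ {s′} → Q s′ → Run P′ s′ R) → Run (P ⨾ P′) s R
  ran e t q >> f with f q
  ... | ran e′ t′ r = ran (seq e e′) (+-mono-≤ t t′) r

  chain : ∀ {P P′ s R} → Run P s (λ s′ → Run P′ s′ R) → Run (P ⨾ P′) s R
  chain r = r >> λ q → q

  run-const : ∀ {i k s Q} → Q ⟨ reg s [ i ↦ k ] , mem s ⟩ → Run (i ≔# k) s Q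
  run-const = ran const ≤-refl

  run-copy : ∀ {i j s Q} → Q ⟨ reg s [ i ↦ reg s j ] , mem s ⟩ → Run (i ≔ j) s Q
  run-copy = ran copy ≤-refl

  run-suc : ∀ {i j s Q} → Q ⟨ reg s [ i ↦ suc (reg s j) ] , mem s ⟩ → Run (i ≔suc j) s Q
  run-suc = ran succ ≤-refl

  run-pred : ∀ {i j s Q} → Q ⟨ reg s [ i ↦ pred (reg s j) ] , mem s ⟩ → Run (i ≔pred j) s Q
  run-pred = ran prec ≤-refl

  run-load : ∀ {i j s Q} → Q ⟨ reg s [ i ↦ mem s (reg s j) ] , mem s ⟩ → Run (i ≔mem[ j ]) s Q
  run-load = ran load ≤-refl

  run-store : ∀ {i j s Q} → Q ⟨ reg s , mem s [ reg s i ↦ reg s j ] ⟩ → Run (mem[ i ]≔ j) s Q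
  run-store = ran store ≤-refl

  run-if : ∀ {i P P′ s Q} →
           (reg s i ≡ 0 → Run P s Q) → (reg s i ≢ 0 → Run P′ s Q) →
           Run (ifZero i then P else P′) s Q
  run-if {i} {s = s} f g with reg s i ≟ 0
  ... | yes p with f p
  ...   | ran e t q = ran (if-zero p e) (s≤s (≤-trans t (m≤m+n _ _))) q
  run-if {i} {s = s} f g | no p with g p
  ...   | ran e t q = ran (if-nonzero p e) (s≤s (≤-trans t (m≤n+m _ _))) q

  -- `I k` is the invariant with `k` iterations to come. The body has to hand the counter back
  -- unchanged, and `k ≤ N` justifies the factor `N` in `cost`.
  run-times : ∀ {c P} (I : ℕ → State → Set) →
    (∀ {k s} → suc k ≤ N → I (suc k) s →
      Run P ⟨ reg s [ c ↦ k ] , mem s ⟩ (λ s′ → I k s′ × reg s′ c ≡ k)) →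
    ∀ {k s} → reg s c ≡ k → k ≤ N → I k s → Run (times c P) s (I 0)
  run-times {c} {P} I body {k} eq k≤N i with go k eq k≤N i
    where
    go : ∀ k {s} → reg s c ≡ k → k ≤ N → I k s →
         ∃₂ λ s′ t → (times c P ⊢ s ⇓ s′ after t) ×
                     t ≤ suc (k * suc (suc (cost N P))) × I 0 s′
    go zero    eq k≤N i = _ , _ , while-stop eq , ≤-refl , i
    go (suc k) {s} eq k<N i with body k<N i
    ... | ran {s′} {t} e t≤ (i′ , eq′) with go k eq′ (<⇒≤ k<N) i′
    ...   | s″ , t′ , e′ , t′≤ , j =
      s″ , _ ,
      while-step (λ z → 1+n≢0 (trans (sym eq) z))
        (seq (subst (λ x → c ≔pred c ⊢ s ⇓ ⟨ reg s [ c ↦ x ] , mem s ⟩ after 1)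
                    (cong pred eq) prec) e) e′ ,
      s≤s (≤-trans (+-mono-≤ (s≤s t≤) t′≤) (≤-reflexive (+-suc (suc (cost N P)) _))) , j
  ... | s′ , t , e , t≤ , i′ =
    ran e (≤-trans t≤ (s≤s (*-monoˡ-≤ (suc (suc (cost N P))) k≤N))) i′

-- An intermediate language

Var : Set
Var = ℕ

-- W holds the configuration under consideration, L the component labels.
data Array : Set where
  W L : Array

record Store : Set where
  constructor store
  field
    var : Var → ℕ
    arr : Array → ℕ → ℕ
    stk : List ℕ

open Store public

updateArray : (Array → ℕ → ℕ) → Array → (ℕ → ℕ) → Array → ℕ → ℕ
updateArray a W f W = f
updateArray a W f L = a L
updateArray a L f W = a W
updateArray a L f L = f

setVar : Store → Var → ℕ → Store
setVar h x v = store (var h [ x ↦ v ]) (arr h) (stk h)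

setCell : Store → Array → ℕ → ℕ → Store
setCell h k i v = store (var h) (updateArray (arr h) k (arr h k [ i ↦ v ])) (stk h)

setStack : Store → List ℕ → Store
setStack h l = store (var h) (arr h) l

infixr 4 _»_

-- loop x c executes c for x = n − 1, …, 0, where n is the number of vertices.
data Command : Set where
  skip                 : Command
  const                : Var → ℕ → Command
  copy succ prec       : Var → Var → Command
  vertexCount          : Var → Command
  monus                : Var → Var → Var → Command
  entry                : Var → Var → Var → Command
  get                  : Var → Array → Var → Command
  put                  : Array → Var → Var → Command
  push pop             : Var → Command
  _»_                  : Command → Command → Command
  branch               : Var → Command → Command → Command
  loop                 : Var → Command → Command

-- The memory beyond the input is divided by residues modulo 3 into the arrays W and
-- L and the stack; Top is the first free cell of the stack.
pattern Acc   = 0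
pattern Ctr   = 1
pattern Ctr′  = 2
pattern Order = 3
pattern Base  = 4
pattern Top   = 5

⌜_⌝ : Var → Register
⌜ x ⌝ = 6 + x

offset : Array → ℕ
offset W = 0
offset L = 1

addOffset : Array → Program
addOffset W = Acc ≔ Acc
addOffset L = Acc ≔suc Acc

address : Array → Var → Program
address k y =
  Acc ≔ Base ⨾ Ctr ≔ ⌜ y ⌝ ⨾ times Ctr (Acc ≔suc Acc ⨾ Acc ≔suc Acc ⨾ Acc ≔suc Acc) ⨾ addOffset k

-- With the successor as the only way to increase a number, adding a product takes two nested loops;
-- this costs no more than a polynomial factor.
addMultiple : Register → Program
addMultiple u = Ctr ≔ u ⨾ times Ctr (Ctr′ ≔ Order ⨾ times Ctr′ (Acc ≔suc Acc))

compile : Command → Program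
compile skip           = Acc ≔ Acc
compile (const x k)    = ⌜ x ⌝ ≔# k
compile (copy x y)     = ⌜ x ⌝ ≔ ⌜ y ⌝
compile (succ x y)     = ⌜ x ⌝ ≔suc ⌜ y ⌝
compile (prec x y)     = ⌜ x ⌝ ≔pred ⌜ y ⌝
compile (vertexCount x) = ⌜ x ⌝ ≔ Order
compile (monus x y z)  = Acc ≔ ⌜ y ⌝ ⨾ Ctr ≔ ⌜ z ⌝ ⨾ times Ctr (Acc ≔pred Acc) ⨾ ⌜ x ⌝ ≔ Acc
-- Address 0 holds the vertex count, hence the successor of `w`; a row of the matrix occupies
-- `Order` cells.
compile (entry x u w)  = Acc ≔suc ⌜ w ⌝ ⨾ addMultiple ⌜ u ⌝ ⨾ ⌜ x ⌝ ≔mem[ Acc ]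
compile (get x k y)    = address k y ⨾ ⌜ x ⌝ ≔mem[ Acc ]
compile (put k y x)    = address k y ⨾ mem[ Acc ]≔ ⌜ x ⌝
compile (push x)       = mem[ Top ]≔ ⌜ x ⌝ ⨾ Top ≔suc Top ⨾ Top ≔suc Top ⨾ Top ≔suc Top
compile (pop x)        = Top ≔pred Top ⨾ Top ≔pred Top ⨾ Top ≔pred Top ⨾ ⌜ x ⌝ ≔mem[ Top ]
compile (c » d)        = compile c ⨾ compile d
compile (branch x c d) = ifZero ⌜ x ⌝ then compile c else compile d
compile (loop x c)     = ⌜ x ⌝ ≔ Order ⨾ times ⌜ x ⌝ (compile c)

-- touches c r is a syntactic test: if it fails, then c leaves r unchanged.
data Component : Set where
  variable′ : Var → Component
  array     : Array → Component
  stack     : Component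

_≡ᶜ_ : Component → Component → Bool
variable′ x ≡ᶜ variable′ y = x ≡ᵇ y
array W     ≡ᶜ array W     = true
array L     ≡ᶜ array L     = true
stack       ≡ᶜ stack       = true
_           ≡ᶜ _           = false

Value : Component → Set
Value (variable′ x) = ℕ
Value (array k)     = ℕ → ℕ
Value stack         = List ℕ

value : Store → ∀ r → Value r
value h (variable′ x) = var h x
value h (array k)     = arr h k
value h stack         = stk h

touches : Command → Component → Bool
touches skip           r = false
touches (const x k)    r = variable′ x ≡ᶜ r
touches (copy x y)     r = variable′ x ≡ᶜ r
touches (succ x y)     r = variable′ x ≡ᶜ r
touches (prec x y)     r = variable′ x ≡ᶜ r
touches (vertexCount x) r = variable′ x ≡ᶜ r
touches (monus x y z)  r = variable′ x ≡ᶜ r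
touches (entry x u w)  r = variable′ x ≡ᶜ r
touches (get x k y)    r = variable′ x ≡ᶜ r
touches (put k y x)    r = array k ≡ᶜ r
touches (push x)       r = stack ≡ᶜ r
touches (pop x)        r = (variable′ x ≡ᶜ r) ∨ (stack ≡ᶜ r)
touches (c » d)        r = touches c r ∨ touches d r
touches (branch x c d) r = touches c r ∨ touches d r
touches (loop x c)     r = (variable′ x ≡ᶜ r) ∨ touches c r

Unchanged : Component → Store → Store → Set
Unchanged r h h′ = value h′ r ≡ value h r

-- For a concrete command and component the premise holds by `refl`, so facts about whatever a
-- command does not touch carry over with no further proof.
Frame : Command → Store → Store → Set
Frame c h h′ = ∀ r → touches c r ≡ false → Unchanged r h h′

∨-falseˡ : ∀ {a b} → a ∨ b ≡ false → a ≡ false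
∨-falseˡ {false} p = refl

∨-falseʳ : ∀ {a b} → a ∨ b ≡ false → b ≡ false
∨-falseʳ {false} p = p

setVar-unchanged : ∀ {h} x {v} r → (variable′ x ≡ᶜ r) ≡ false → Unchanged r h (setVar h x v)
setVar-unchanged x (variable′ y) p rewrite p = refl
setVar-unchanged x (array k)     p = refl
setVar-unchanged x stack         p = refl

setCell-unchanged : ∀ {h} k {i v} r → (array k ≡ᶜ r) ≡ false → Unchanged r h (setCell h k i v)
setCell-unchanged k (variable′ x) p = refl
setCell-unchanged W (array L)     p = refl
setCell-unchanged L (array W)     p = refl
setCell-unchanged k stack         p = refl

setStack-unchanged : ∀ {h l} r → (stack ≡ᶜ r) ≡ false → Unchanged r h (setStack h l)
setStack-unchanged (variable′ x) p = refl
setStack-unchanged (array k)     p = refl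

-- Simulation of the intermediate language by the machine

module Machine (n N : ℕ) (n≤N : n ≤ N) (A : ℕ → ℕ → ℕ) where

  open Logic N public

  base : ℕ
  base = suc (n * n)

  cell : ℕ → ℕ → ℕ
  cell k i = base + (i * 3 + k)

  -- The index of an element is the number of elements below it, so the bottom lies in cell 0 and
  -- `Top` is the cell indexed by the height of the stack.
  Stored : (ℕ → ℕ) → List ℕ → Set
  Stored m []      = ⊤
  Stored m (x ∷ l) = m (cell 2 (length l)) ≡ x × Stored m l

  record Sim (h : Store) (s : State) : Set where
    field
      variables : ∀ x → reg s ⌜ x ⌝ ≡ var h x
      nr        : reg s Order ≡ n
      br        : reg s Base ≡ base
      sp        : reg s Top ≡ cell 2 (length (stk h))
      entries   : ∀ {u w} → u < n → w < n → mem s (suc (u * n + w)) ≡ A u w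
      arrays    : ∀ k i → mem s (cell (offset k) i) ≡ arr h k i
      stored    : Stored (mem s) (stk h)
  open Sim

  -- The scratch registers Acc, Ctr and Ctr′ are outside the simulation relation.
  record Same (s s′ : State) : Set where
    constructor same
    field
      regs : ∀ i → reg s′ (3 + i) ≡ reg s (3 + i)
      mems : mem s′ ≡ mem s

  sim-same : ∀ {h s s′} → Same s s′ → Sim h s → Sim h s′
  sim-same {h} {s} {⟨ r , m ⟩} (same f refl) σ = record
    { variables = λ x → trans (f (3 + x)) (variables σ x)
    ; nr        = trans (f 0) (nr σ)
    ; br        = trans (f 1) (br σ)
    ; sp        = trans (f 2) (sp σ)
    ; entries   = entries σ
    ; arrays    = arrays σ
    ; stored    = stored σ
    }

  sim-setVar : ∀ {h s} x {v v′} → v ≡ v′ → Sim h s →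
               Sim (setVar h x v′) ⟨ reg s [ ⌜ x ⌝ ↦ v ] , mem s ⟩
  sim-setVar {h} x {v} refl σ = record
    { variables = λ y → cong (if x ≡ᵇ y then v else_) (variables σ y)
    ; nr = nr σ ; br = br σ ; sp = sp σ
    ; entries = entries σ ; arrays = arrays σ ; stored = stored σ }

  3*-injective : ∀ i j {k l} → k < 3 → l < 3 → i * 3 + k ≡ j * 3 + l → i ≡ j × k ≡ l
  3*-injective zero    zero    p q e = refl , e
  3*-injective zero    (suc j) (s≤s (s≤s (s≤s ()))) q refl
  3*-injective (suc i) zero    p (s≤s (s≤s (s≤s ()))) refl
  3*-injective (suc i) (suc j) p q e
    with e₁ , e₂ ← 3*-injective i j p q (suc-injective (suc-injective (suc-injective e))) =
    cong suc e₁ , e₂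

  -- The reason for separating by residues: it needs no bounds on indices, so the stack can grow
  -- freely and no write to one component reaches another.
  cell-injective : ∀ {i j k l} → k < 3 → l < 3 → cell k i ≡ cell l j → i ≡ j × k ≡ l
  cell-injective {i} {j} p q e = 3*-injective i j p q (+-cancelˡ-≡ base _ _ e)

  offset<3 : ∀ k → offset k < 3
  offset<3 W = s≤s z≤n
  offset<3 L = s≤s (s≤s z≤n)

  offset≢2 : ∀ k → offset k ≢ 2
  offset≢2 W ()
  offset≢2 L ()

  entry<base : ∀ {u w} → u < n → w < n → suc (u * n + w) < base
  entry<base {u} {w} u<n w<n = s≤s (begin-strict
    u * n + w  <⟨ +-monoʳ-< (u * n) w<n ⟩
    u * n + n  ≡⟨ +-comm (u * n) n ⟩
    suc u * n  ≤⟨ *-monoˡ-≤ n u<n ⟩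
    n * n      ∎)
    where open ≤-Reasoning

  entry-update : ∀ {m : ℕ → ℕ} k i v {u w} → u < n → w < n →
                 (m [ cell k i ↦ v ]) (suc (u * n + w)) ≡ m (suc (u * n + w))
  entry-update {m} k i v u<n w<n = update-other m v
    (≢-sym (<⇒≢ (<-≤-trans (entry<base u<n w<n) (m≤m+n base _))))

  sim-setCell : ∀ {h s} k i {v v′} → v ≡ v′ → Sim h s →
                Sim (setCell h k i v′) ⟨ reg s , mem s [ cell (offset k) i ↦ v ] ⟩
  sim-setCell {h} {s} k i {v} refl σ = record
    { variables = variables σ ; nr = nr σ ; br = br σ ; sp = sp σ
    ; entries = λ p q → trans (entry-update {mem s} (offset k) i v p q) (entries σ p q)
    ; arrays = arrays′ k
    ; stored = stored′ (stk h) (stored σ) }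
    where
    hit : ∀ k j → (mem s [ cell (offset k) i ↦ v ]) (cell (offset k) j) ≡ (arr h k [ i ↦ v ]) j
    hit k j with i ≟ j
    ... | yes refl = trans (update-same (mem s) (cell (offset k) i) v)
                           (sym (update-same (arr h k) i v))
    ... | no i≢j   = trans
      (update-other (mem s) v (i≢j ∘ proj₁ ∘ cell-injective (offset<3 k) (offset<3 k)))
      (trans (arrays σ k j) (sym (update-other (arr h k) v i≢j)))
    miss : ∀ k l j → offset k ≢ offset l →
           (mem s [ cell (offset k) i ↦ v ]) (cell (offset l) j) ≡ arr h l j
    miss k l j k≢l = trans
      (update-other (mem s) v (k≢l ∘ proj₂ ∘ cell-injective {i} {j} (offset<3 k) (offset<3 l)))
      (arrays σ l j)
    arrays′ : ∀ k l j → (mem s [ cell (offset k) i ↦ v ]) (cell (offset l) j) ≡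
              updateArray (arr h) k (arr h k [ i ↦ v ]) l j
    arrays′ W W j = hit W j
    arrays′ W L j = miss W L j λ ()
    arrays′ L W j = miss L W j λ ()
    arrays′ L L j = hit L j
    stored′ : ∀ l → Stored (mem s) l → Stored (mem s [ cell (offset k) i ↦ v ]) l
    stored′ []      _       = tt
    stored′ (x ∷ l) (p , q) =
      trans (update-other (mem s) v
        (offset≢2 k ∘ proj₂ ∘ cell-injective {i} {length l} (offset<3 k) ≤-refl)) p ,
      stored′ l q

  cell-suc : ∀ k i → cell k (suc i) ≡ 3 + cell k i
  cell-suc k i = lemma base (i * 3 + k)
    where
    lemma : ∀ a b → a + (3 + b) ≡ 3 + (a + b)
    lemma = solve-∀

  -- The new register file `r` is described only by its relevant values, since the compiled push
  -- raises `Top` by three separate instructions.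
  sim-push : ∀ {h s r} x {v} → v ≡ x →
             (∀ y → r ⌜ y ⌝ ≡ reg s ⌜ y ⌝) → r Order ≡ reg s Order → r Base ≡ reg s Base →
             r Top ≡ 3 + reg s Top → Sim h s →
             Sim (setStack h (x ∷ stk h)) ⟨ r , mem s [ reg s Top ↦ v ] ⟩
  sim-push {h} {s} x {v} refl rv rn rb rs σ rewrite sp σ = record
    { variables = λ y → trans (rv y) (variables σ y)
    ; nr = trans rn (nr σ) ; br = trans rb (br σ)
    ; sp = trans rs (sym (cell-suc 2 top))
    ; entries = λ p q → trans (entry-update {mem s} 2 top v p q) (entries σ p q)
    ; arrays = λ k i → trans
        (update-other (mem s) v
          (offset≢2 k ∘ sym ∘ proj₂ ∘ cell-injective {top} {i} ≤-refl (offset<3 k)))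
        (arrays σ k i)
    ; stored = update-same (mem s) (cell 2 top) v , below (stk h) ≤-refl (stored σ) }
    where
    top = length (stk h)
    -- Each tail of the old stack has its head at an index below `top`, the cell being written.
    below : ∀ l → length l ≤ top → Stored (mem s) l → Stored (mem s [ cell 2 top ↦ v ]) l
    below []      _ _       = tt
    below (y ∷ l) l<t (p , q) =
      trans (update-other (mem s) v
        (<⇒≢ l<t ∘ sym ∘ proj₁ ∘ cell-injective {top} {length l} ≤-refl ≤-refl)) p ,
      below l (<⇒≤ l<t) q

  sim-pop : ∀ {h s r a l} → stk h ≡ a ∷ l →
            (∀ y → r ⌜ y ⌝ ≡ reg s ⌜ y ⌝) → r Order ≡ reg s Order → r Base ≡ reg s Base →
            r Top ≡ pred (pred (pred (reg s Top))) → Sim h s →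
            Sim (setStack h l) ⟨ r , mem s ⟩ × mem s (r Top) ≡ a
  sim-pop {store _ _ _} {s} {l = l} refl rv rn rb rs σ rewrite sp σ = record
    { variables = λ y → trans (rv y) (variables σ y)
    ; nr = trans rn (nr σ) ; br = trans rb (br σ)
    ; sp = eq
    ; entries = entries σ ; arrays = arrays σ ; stored = proj₂ (stored σ) } ,
    trans (cong (mem s) eq) (proj₁ (stored σ))
    where
    eq = trans rs (cong (pred ∘ pred ∘ pred) (cell-suc 2 (length l)))

  -- Commands have no semantics of their own: their meaning is that of the compiled program. The
  -- frame property is part of the conclusion, so postconditions need to mention only what changes.
  record WP (c : Command) (h : Store) (Q : Store → Set) : Set where
    constructor wp
    field
      sound : ∀ {s} → Sim h s →
              Run (compile c) s (λ s′ → Σ Store λ h′ → Sim h′ s′ × Frame c h h′ × Q h′)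
  open WP public

  run-address : ∀ k y {h s} → Sim h s → var h y ≤ N →
                Run (address k y) s (λ s′ → Same s s′ × reg s′ Acc ≡ cell (offset k) (var h y))
  run-address k y {h} {s} σ y≤N =
    chain (run-copy (chain (run-copy (
      run-times I step refl (subst (_≤ N) (sym (variables σ y)) y≤N) start >> offset′ k))))
    where
    I : ℕ → State → Set
    I j s′ = Same s s′ × reg s′ Acc + j * 3 ≡ base + var h y * 3
    start : I (reg s ⌜ y ⌝) _
    start = same (λ i → refl) refl , cong₂ (λ a b → a + b * 3) (br σ) (variables σ y)
    step : ∀ {j s′} → suc j ≤ N → I (suc j) s′ → Run (Acc ≔suc Acc ⨾ Acc ≔suc Acc ⨾ Acc ≔suc Acc)
             ⟨ reg s′ [ Ctr ↦ j ] , mem s′ ⟩ (λ s″ → I j s″ × reg s″ Ctr ≡ j)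
    step {j} {s′} _ (same f refl , e) = chain (run-suc (chain (run-suc (run-suc
      ((same f refl , trans (shift (reg s′ Acc) (j * 3)) e) , refl)))))
      where
      shift : ∀ a b → 3 + a + b ≡ a + (3 + b)
      shift = solve-∀
    offset′ : ∀ k {s′} → I 0 s′ → Run (addOffset k) s′
                (λ s″ → Same s s″ × reg s″ Acc ≡ cell (offset k) (var h y))
    offset′ W (same f refl , e) = run-copy (same f refl ,
      trans (sym (+-identityʳ _)) (trans e (cong (base +_) (sym (+-identityʳ _)))))
    offset′ L (same f refl , e) = run-suc (same f refl ,
      trans (cong suc (trans (sym (+-identityʳ _)) e)) (shift base (var h y * 3)))
      where
      shift : ∀ a b → suc (a + b) ≡ a + (b + 1)
      shift = solve-∀

  run-addMultiple : ∀ u {s} → reg s Order ≡ n → reg s u ≤ N →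
    Run (addMultiple u) s (λ s′ → Same s s′ × reg s′ Acc ≡ reg s Acc + reg s u * n)
  run-addMultiple u {s} nr u≤N = chain (run-copy (weaken finish (run-times I step refl u≤N
    (same (λ _ → refl) refl , refl))))
    where
    I : ℕ → State → Set
    I j s′ = Same s s′ × reg s′ Acc + j * n ≡ reg s Acc + reg s u * n
    finish : ∀ {s′} → I 0 s′ → Same s s′ × reg s′ Acc ≡ reg s Acc + reg s u * n
    finish (p , e) = p , trans (sym (+-identityʳ _)) e
    step : ∀ {j s′} → suc j ≤ N → I (suc j) s′ → Run (Ctr′ ≔ Order ⨾ times Ctr′ (Acc ≔suc Acc))
             ⟨ reg s′ [ Ctr ↦ j ] , mem s′ ⟩ (λ s″ → I j s″ × reg s″ Ctr ≡ j)
    step {j} {s′} _ (same f refl , e) = chain (run-copy (weaken finish′ (run-times J step′ nr′ n≤N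
      ((same f refl , trans (+-assoc (reg s′ Acc) n (j * n)) e) , refl))))
      where
      nr′ : reg s′ Order ≡ n
      nr′ = trans (f 0) nr
      J : ℕ → State → Set
      J i s″ = (Same s s″ × reg s″ Acc + i + j * n ≡ reg s Acc + reg s u * n) × reg s″ Ctr ≡ j
      finish′ : ∀ {s″} → J 0 s″ → I j s″ × reg s″ Ctr ≡ j
      finish′ ((p , e) , q) = (p , trans (cong (_+ j * n) (sym (+-identityʳ _))) e) , q
      step′ : ∀ {i s″} → suc i ≤ N → J (suc i) s″ → Run (Acc ≔suc Acc)
                ⟨ reg s″ [ Ctr′ ↦ i ] , mem s″ ⟩ (λ s‴ → J i s‴ × reg s‴ Ctr′ ≡ i)
      step′ {i} {s″} _ ((same g refl , e) , q) = run-suc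
        (((same g refl , trans (cong (_+ j * n) (sym (+-suc (reg s″ Acc) i))) e) , q) , refl)

  wp-const : ∀ {x k h Q} → Q (setVar h x k) → WP (const x k) h Q
  wp-const {x} q = wp λ σ → run-const (_ , sim-setVar x refl σ , setVar-unchanged x , q)

  wp-skip : ∀ {h Q} → Q h → WP skip h Q
  wp-skip q = wp λ σ → run-copy (_ , sim-same (same (λ _ → refl) refl) σ , (λ _ _ → refl) , q)

  wp-copy : ∀ {x y h Q} → Q (setVar h x (var h y)) → WP (copy x y) h Q
  wp-copy {x} {y} q = wp λ σ →
    run-copy (_ , sim-setVar x (variables σ y) σ , setVar-unchanged x , q)

  wp-succ : ∀ {x y h Q} → Q (setVar h x (suc (var h y))) → WP (succ x y) h Q
  wp-succ {x} {y} q = wp λ σ →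
    run-suc (_ , sim-setVar x (cong suc (variables σ y)) σ , setVar-unchanged x , q)

  wp-prec : ∀ {x y h Q} → Q (setVar h x (pred (var h y))) → WP (prec x y) h Q
  wp-prec {x} {y} q = wp λ σ →
    run-pred (_ , sim-setVar x (cong pred (variables σ y)) σ , setVar-unchanged x , q)

  wp-vertexCount : ∀ {x h Q} → Q (setVar h x n) → WP (vertexCount x) h Q
  wp-vertexCount {x} q = wp λ σ → run-copy (_ , sim-setVar x (nr σ) σ , setVar-unchanged x , q)

  wp-monus : ∀ {x y z h Q} → var h z ≤ N → Q (setVar h x (var h y ∸ var h z)) → WP (monus x y z) h Q
  wp-monus {x} {y} {z} {h} {Q} z≤N q = wp go
    where
    go : ∀ {s} → Sim h s → Run (compile (monus x y z)) s
           (λ s′ → Σ Store λ h′ → Sim h′ s′ × Frame (monus x y z) h h′ × Q h′)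
    go {s} σ = chain (run-copy (chain (run-copy (
      run-times I step refl (subst (_≤ N) (sym (variables σ z)) z≤N)
        (same (λ _ → refl) refl , refl) >>
      λ (p , e) → run-copy (_ , sim-setVar x (trans e (cong₂ _∸_ (variables σ y) (variables σ z)))
        (sim-same p σ) , setVar-unchanged x , q)))))
      where
      I : ℕ → State → Set
      I j s′ = Same s s′ × reg s′ Acc ∸ j ≡ reg s ⌜ y ⌝ ∸ reg s ⌜ z ⌝
      step : ∀ {j s′} → suc j ≤ N → I (suc j) s′ → Run (Acc ≔pred Acc)
               ⟨ reg s′ [ Ctr ↦ j ] , mem s′ ⟩ (λ s″ → I j s″ × reg s″ Ctr ≡ j)
      step {j} {s′} _ (same f refl , e) =
        run-pred ((same f refl , trans (pred-∸ (reg s′ Acc)) e) , refl)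
        where
        pred-∸ : ∀ a → pred a ∸ j ≡ a ∸ suc j
        pred-∸ zero    = 0∸n≡0 j
        pred-∸ (suc a) = refl

  wp-entry : ∀ {x u w h Q} → var h u < n → var h w < n →
             Q (setVar h x (A (var h u) (var h w))) → WP (entry x u w) h Q
  wp-entry {x} {u} {w} {h} {Q} u<n w<n q = wp λ {s} σ →
    chain (run-suc (run-addMultiple ⌜ u ⌝ (nr σ)
        (subst (_≤ N) (sym (variables σ u)) (<⇒≤ (<-≤-trans u<n n≤N))) >>
      λ { {s′} (same f refl , e) → run-load (_ ,
        sim-setVar x (trans (cong (mem s′) (trans e (lemma σ))) (entries σ u<n w<n))
          (sim-same (same f refl) σ) ,
        setVar-unchanged x , q) }))
    where
    lemma : ∀ {s} → Sim h s →
            suc (reg s ⌜ w ⌝) + reg s ⌜ u ⌝ * n ≡ suc (var h u * n + var h w)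
    lemma {s} σ rewrite variables σ u | variables σ w = cong suc (+-comm (var h w) _)

  wp-get : ∀ {x k y h Q} → var h y ≤ N → Q (setVar h x (arr h k (var h y))) → WP (get x k y) h Q
  wp-get {x} {k} {y} {h} y≤N q = wp λ σ → run-address k y σ y≤N >>
    λ { {s′} (same f refl , e) → run-load (_ ,
      sim-setVar x (trans (cong (mem s′) e) (arrays σ k (var h y))) (sim-same (same f refl) σ) ,
      setVar-unchanged x , q) }

  wp-put : ∀ {x k y h Q} → var h y ≤ N → Q (setCell h k (var h y) (var h x)) → WP (put k y x) h Q
  wp-put {x} {k} {y} {h} y≤N q = wp λ σ → run-address k y σ y≤N >>
    λ { {s′} (same f refl , e) → run-store (_ ,
      subst (λ a → Sim _ ⟨ reg s′ , mem s′ [ a ↦ reg s′ ⌜ x ⌝ ] ⟩) (sym e)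
        (sim-setCell k (var h y) (trans (f (3 + x)) (variables σ x)) (sim-same (same f refl) σ)) ,
      setCell-unchanged k {var h y} {var h x} , q) }

  wp-push : ∀ {x h Q} → Q (setStack h (var h x ∷ stk h)) → WP (push x) h Q
  wp-push {x} q = wp λ σ → chain (run-store (chain (run-suc (chain (run-suc (run-suc (_ ,
    sim-push _ (variables σ x) (λ _ → refl) refl refl refl σ , setStack-unchanged , q)))))))

  wp-pop : ∀ {x h Q a l} → stk h ≡ a ∷ l → Q (setVar (setStack h l) x a) → WP (pop x) h Q
  wp-pop {x} {h} {l = l} eq q = wp λ {s} σ →
    let σ′ , e = sim-pop {r = reg s [ Top ↦ pred (pred (pred (reg s Top))) ]}
                   eq (λ _ → refl) refl refl refl σ
    in chain (run-pred (chain (run-pred (chain (run-pred (run-load (_ ,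
      sim-same {s = ⟨ reg s [ Top ↦ pred (pred (pred (reg s Top))) ] [ ⌜ x ⌝ ↦ mem s _ ] , mem s ⟩}
        -- The three decrements leave nested updates of `Top`, which agree with a single update only
        -- pointwise.
        (same (λ { 0 → refl ; 1 → refl ; 2 → refl ; (suc (suc (suc i))) → refl }) refl)
        (sim-setVar x e σ′) ,
      (λ r p → trans (setVar-unchanged x r (∨-falseˡ p))
                     (setStack-unchanged {h} {l} r (∨-falseʳ {variable′ x ≡ᶜ r} p))) ,
      q)))))))

  infixr 4 _»»_
  _»»_ : ∀ {c d h Q R} → WP c h Q → (∀ h′ → Frame c h h′ → Q h′ → WP d h′ R) → WP (c » d) h R
  _»»_ {c} p f = wp λ σ → sound p σ >> λ (h′ , σ′ , φ , q) →
    weaken (λ (h″ , σ″ , φ′ , q′) → h″ , σ″ ,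
      (λ r e → trans (φ′ r (∨-falseʳ {touches c r} e)) (φ r (∨-falseˡ e))) , q′)
      (sound (f h′ φ q) σ′)

  wp-seq : ∀ {c d h R} → WP c h (λ h′ → WP d h′ R) → WP (c » d) h R
  wp-seq p = p »» λ _ _ q → q

  wp-weaken : ∀ {c h Q R} → (∀ h′ → Frame c h h′ → Q h′ → R h′) → WP c h Q → WP c h R
  wp-weaken f p = wp λ σ → weaken (λ (h′ , σ′ , φ , q) → h′ , σ′ , φ , f h′ φ q) (sound p σ)

  wp-branch : ∀ {x c d h Q} → (var h x ≡ 0 → WP c h Q) → (var h x ≢ 0 → WP d h Q) →
              WP (branch x c d) h Q
  wp-branch {x} {c} f g = wp λ σ → run-if
    (λ e → weaken (λ (h′ , σ′ , φ , q) → h′ , σ′ , (λ r e → φ r (∨-falseˡ e)) , q)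
      (sound (f (trans (sym (variables σ x)) e)) σ))
    (λ e → weaken (λ (h′ , σ′ , φ , q) → h′ , σ′ , (λ r e → φ r (∨-falseʳ {touches c r} e)) , q)
      (sound (g (e ∘ trans (variables σ x))) σ))

  -- `I k` holds once the indices from `k` on are processed. The register of `x` is itself the loop
  -- counter, hence the condition that the body does not touch `x`.
  wp-loop : ∀ {x c h Q} (I : ℕ → Store → Set) → touches c (variable′ x) ≡ false →
    I n (setVar h x n) →
    (∀ k h′ → k < n → Frame (loop x c) h h′ → I (suc k) h′ → WP c (setVar h′ x k) (I k)) →
    (∀ h′ → Frame (loop x c) h h′ → I 0 h′ → Q h′) →
    WP (loop x c) h Q
  wp-loop {x} {c} {h} I untouched start step finish = wp λ {s} σ →
    chain (run-copy (weaken (λ (_ , h′ , σ′ , φ , i) → h′ , σ′ , φ , finish h′ φ i)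
      (run-times J step′ (trans (update-same (reg s) ⌜ x ⌝ _) (nr σ)) n≤N
        (≤-refl , _ , sim-setVar x (nr σ) σ ,
         (λ r e → setVar-unchanged x r (∨-falseˡ e)) , start))))
    where
    J : ℕ → State → Set
    J k s = k ≤ n × Σ Store λ h′ → Sim h′ s × Frame (loop x c) h h′ × I k h′
    step′ : ∀ {k s} → suc k ≤ N → J (suc k) s →
            Run (compile c) ⟨ reg s [ ⌜ x ⌝ ↦ k ] , mem s ⟩ (λ s′ → J k s′ × reg s′ ⌜ x ⌝ ≡ k)
    step′ {k} _ (k<n , h′ , σ , φ , i) = weaken
      (λ (h″ , σ″ , φ″ , i″) →
        (<⇒≤ k<n , h″ , σ″ ,
         (λ r e → trans (φ″ r (∨-falseʳ {variable′ x ≡ᶜ r} e))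
                  (trans (setVar-unchanged x r (∨-falseˡ e)) (φ r e))) , i″) ,
        trans (variables σ″ x) (trans (φ″ (variable′ x) untouched) (update-same (var h′) x k)))
      (sound (step k h′ k<n φ i) (sim-setVar x refl σ))

-- The program

$ans   = 0
$cnt   = 1
$j     = 2
$x     = 3
$y     = 4
$u     = 5
$w     = 6
$a     = 7
$deg   = 8
$best  = 9
$v     = 10
$d     = 11
$z     = 12
$p     = 13
$q     = 14
$found = 15

when unless : Var → Command → Command
when   x c = branch x skip c
unless x c = branch x c skip

-- Some number that is zero if and only if y and z are equal.
distance : Var → Var → Var → Command
distance d y z = monus d y z » unless d (monus d z y)

popCell : Command
popCell = pop $y » put W $j $y » succ $j $j

-- Cell 0 is pushed last and comes off first, whereas `loop` counts down; the ascending index `$j`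
-- reconciles the two orders.
popConfig : Command
popConfig = const $j 0 » loop $x popCell

countNeighbour : Command
countNeighbour = entry $a $u $w » when $a (get $y W $w » unless $y (succ $deg $deg))

countDegree : Command
countDegree = const $deg 0 » loop $w countNeighbour

considerVertex : Command
considerVertex = get $y W $u » unless $y (
  countDegree » monus $d $best $deg »
  when $d (copy $best $deg » copy $v $u » const $found 1))

selectVertex : Command
selectVertex =
  -- The initial `$best` is n + 1, above every degree, so the first undecided vertex met is always
  -- accepted.
  const $found 0 » vertexCount $best » succ $best $best » loop $u considerVertex

pushChildCell : Command
pushChildCell =
  get $y W $w » unless $y (entry $a $z $w » when $a (const $y 2)) »
  distance $d $w $z » unless $d (const $y 1) » push $y

pushChild : Command
pushChild = loop $w pushChildCell » succ $cnt $cnt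

pushChildAt : Command
pushChildAt = entry $a $v $u » when $a (get $y W $u » unless $y (copy $z $u » pushChild))

-- `W` keeps the parent configuration throughout, so all children are computed from it and pushed
-- before any of them is popped.
pushChildren : Command
pushChildren = loop $u pushChildAt » copy $z $v » pushChild

initLabels : Command
initLabels = loop $x (put L $x $x)

relabel : Command
relabel = loop $x (get $y L $x » distance $d $y $p » unless $d (put L $x $q))

-- The predecessor tells 1 from 2; that it also sends 0 to 0 is harmless, as no vertex
-- is undecided at a leaf.
outside : Var → Command → Command
outside x c = get $y W x » prec $y $y » when $y c

-- The labels of `$u` and `$w` are copied to `$p` and `$q` first, because `relabel` may overwrite
-- the label of `$u` in `L` halfway through.
mergeLabels : Command
mergeLabels = loop $u (loop $w (
  entry $a $u $w » when $a (outside $u (outside $w (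
    get $p L $u » get $q L $w » relabel)))))

compareLabels : Command
compareLabels = loop $u (loop $w (
  outside $u (outside $w (
    get $p L $u » get $q L $w » distance $d $p $q » when $d (const $ans 1)))))

testLeaf : Command
testLeaf = initLabels » mergeLabels » compareLabels

processConfig : Command
processConfig =
  prec $cnt $cnt » popConfig » selectVertex » branch $found testLeaf pushChildren

pushRoot : Command
pushRoot = const $y 0 » loop $w (push $y) » const $cnt 1

-- Sums and indicator functions

Σ< : ℕ → (ℕ → ℕ) → ℕ
Σ< zero    f = 0
Σ< (suc n) f = Σ< n f + f n

Σ<-cong : ∀ n {f g : ℕ → ℕ} → (∀ i → i < n → f i ≡ g i) → Σ< n f ≡ Σ< n g
Σ<-cong zero    p = refl
Σ<-cong (suc n) p = cong₂ _+_ (Σ<-cong n λ i i<n → p i (m<n⇒m<1+n i<n)) (p n ≤-refl)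

Σ<-+ : ∀ n (f g : ℕ → ℕ) → Σ< n (λ i → f i + g i) ≡ Σ< n f + Σ< n g
Σ<-+ zero    f g = refl
Σ<-+ (suc n) f g rewrite Σ<-+ n f g = interchange (Σ< n f) (Σ< n g) (f n) (g n)
  where
  interchange : ∀ a b c d → (a + b) + (c + d) ≡ (a + c) + (b + d)
  interchange = solve-∀

Σ<-bound : ∀ n {f : ℕ → ℕ} → (∀ i → f i ≤ 1) → Σ< n f ≤ n
Σ<-bound zero    p = z≤n
Σ<-bound (suc n) {f} p = ≤-trans (+-mono-≤ (Σ<-bound n p) (p n)) (≤-reflexive (+-comm n 1))

Σ<-ones : ∀ n → Σ< n (λ _ → 1) ≡ n
Σ<-ones zero    = refl
Σ<-ones (suc n) = trans (cong (_+ 1) (Σ<-ones n)) (+-comm n 1)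

Σ<-zero : ∀ n {f : ℕ → ℕ} → (∀ i → i < n → f i ≡ 0) → Σ< n f ≡ 0
Σ<-zero zero    p = refl
Σ<-zero (suc n) p = cong₂ _+_ (Σ<-zero n λ i i<n → p i (m<n⇒m<1+n i<n)) (p n ≤-refl)

-- This and `Σ<-count` are the two steps of a counter in a descending loop: the count so far plus
-- the sum over the indices still to come stays constant.
Σ<-skip : ∀ x (f : ℕ → ℕ) k → f k ≡ 0 → x + Σ< k f ≡ x + Σ< (suc k) f
Σ<-skip x f k e = cong (x +_) (trans (sym (+-identityʳ _)) (cong (Σ< k f +_) (sym e)))

Σ<-count : ∀ x (f : ℕ → ℕ) k → f k ≡ 1 → suc x + Σ< k f ≡ x + Σ< (suc k) f
Σ<-count x f k e = trans (sym (+-suc x _))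
  (cong (x +_) (trans (+-comm 1 _) (cong (Σ< k f +_) (sym e))))

point : ℕ → ℕ → ℕ
point z w = if does (w ≟ z) then 1 else 0

Σ<-point : ∀ n {z} → z < n → Σ< n (point z) ≡ 1
Σ<-point (suc n) {z} z<1+n with n ≟ z
... | yes refl = cong₂ _+_
  (Σ<-zero n λ i i<n → cong (if_then 1 else 0) (dec-false (i ≟ n) (<⇒≢ i<n)))
  (cong (if_then 1 else 0) (dec-true (n ≟ n) refl))
... | no n≢z = cong₂ _+_
  (Σ<-point n (≤∧≢⇒< (≤-pred z<1+n) (≢-sym n≢z)))
  (cong (if_then 1 else 0) (dec-false (n ≟ z) n≢z))

isZero : ℕ → ℕ
isZero zero    = 1
isZero (suc _) = 0

-- Matrix entries are known only to be zero or nonzero, so a conditional takes the place of a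
-- product of indicators.
guard : ℕ → ℕ → ℕ
guard zero    _ = 0
guard (suc _) x = x

isZero≤1 : ∀ x → isZero x ≤ 1
isZero≤1 zero    = ≤-refl
isZero≤1 (suc _) = z≤n

guard≤1 : ∀ x {y} → y ≤ 1 → guard x y ≤ 1
guard≤1 zero    _ = z≤n
guard≤1 (suc _) p = p

guard-isZero≡1 : ∀ {a x} → a ≢ 0 → x ≡ 0 → guard a (isZero x) ≡ 1
guard-isZero≡1 {zero}  a≢0 _    = contradiction refl a≢0
guard-isZero≡1 {suc _} _   refl = refl

guard-isZero≡0 : ∀ a {x} → x ≢ 0 → guard a (isZero x) ≡ 0
guard-isZero≡0 zero            _   = refl
guard-isZero≡0 (suc _) {zero}  x≢0 = contradiction refl x≢0
guard-isZero≡0 (suc _) {suc _} _   = refl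

-- The value is 0 for a vertex on which no decision has been made, 1 for a chosen
-- vertex and 2 for a vertex with a chosen neighbour.
Config : Set
Config = ℕ → ℕ

seg : Config → ℕ → ℕ → List ℕ → List ℕ
seg c i zero    rest = rest
seg c i (suc k) rest = c i ∷ seg c (suc i) k rest

mark : ℕ → ℕ → ℕ
mark zero    (suc _) = 2
mark x       _       = x

-- Popping a configuration, selecting a vertex, pushing the children

module Search (n N : ℕ) (n≤N : n ≤ N) (A : ℕ → ℕ → ℕ) where

  open Machine n N n≤N A public

  <n⇒≤N : ∀ {i} → i < n → i ≤ N
  <n⇒≤N i<n = <⇒≤ (<-≤-trans i<n n≤N)

  remaining : Config → ℕ
  remaining c = Σ< n λ i → isZero (c i)

  neighbour : Config → ℕ → ℕ → ℕ
  neighbour c u w = guard (A u w) (isZero (c w))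

  degree : Config → ℕ → ℕ
  degree c u = Σ< n (neighbour c u)

  degree≤n : ∀ c u → degree c u ≤ n
  degree≤n c u = Σ<-bound n λ i → guard≤1 (A u i) (isZero≤1 (c i))

  child : Config → ℕ → Config
  child c z w = if does (w ≟ z) then 1 else mark (c w) (A z w)

  wp-when : ∀ {x c h Q} → (var h x ≡ 0 → Q h) → (var h x ≢ 0 → WP c h Q) → WP (when x c) h Q
  wp-when f g = wp-branch (λ e → wp-skip (f e)) g

  wp-unless : ∀ {x c h Q} → (var h x ≡ 0 → WP c h Q) → (var h x ≢ 0 → Q h) → WP (unless x c) h Q
  wp-unless f g = wp-branch f (λ e → wp-skip (g e))

  wp-distance : ∀ {d y z h Q} → (d ≡ᵇ y) ≡ false → (d ≡ᵇ z) ≡ false →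
    var h y ≤ N → var h z ≤ N →
    (∀ h′ → Frame (distance d y z) h h′ → arr h′ ≡ arr h →
       (var h′ d ≡ 0 → var h y ≡ var h z) → (var h y ≡ var h z → var h′ d ≡ 0) → Q h′) →
    WP (distance d y z) h Q
  wp-distance {d} {y} {z} {h} {Q} d≢y d≢z y≤N z≤N q =
    wp-weaken {Q = P} (λ h′ φ (e , p , p′) → q h′ φ e p p′)
    (wp-seq (wp-monus z≤N (wp-unless
      (λ e → wp-monus (subst (_≤ N) (sym (other y d≢y)) y≤N) (refl ,
        (λ e′ → ≤-antisym
          (m∸n≡0⇒m≤n (trans (sym (update-same (var h) d _)) e))
          (m∸n≡0⇒m≤n (trans (sym second) e′))) ,
        (λ e′ → trans second (m≤n⇒m∸n≡0 (≤-reflexive (sym e′))))))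
      (λ ne → refl , (λ e → contradiction e ne) ,
        (λ e → trans (update-same (var h) d _) (m≤n⇒m∸n≡0 (≤-reflexive e)))))))
    where
    P : Store → Set
    P h′ = arr h′ ≡ arr h × (var h′ d ≡ 0 → var h y ≡ var h z) × (var h y ≡ var h z → var h′ d ≡ 0)
    r = var h [ d ↦ var h y ∸ var h z ]
    other : ∀ x → (d ≡ᵇ x) ≡ false → r x ≡ var h x
    other x p rewrite p = refl
    second : (r [ d ↦ r z ∸ r y ]) d ≡ var h z ∸ var h y
    second = trans (update-same r d _) (cong₂ _∸_ (other z d≢z) (other y d≢y))

  popConfig-spec : ∀ {h c rest} → stk h ≡ seg c 0 n rest →
    WP popConfig h λ h′ → stk h′ ≡ rest × (∀ i → i < n → arr h′ W i ≡ c i)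
  popConfig-spec {h} {c} {rest} eq =
    wp-seq (wp-const (wp-loop I refl (refl , eq , λ _ ()) step finish))
    where
    I : ℕ → Store → Set
    I k h = var h $j + k ≡ n × stk h ≡ seg c (var h $j) k rest ×
            (∀ i → i < var h $j → arr h W i ≡ c i)
    step : ∀ k h′ → k < n → Frame (loop $x popCell) (setVar h $j 0) h′ → I (suc k) h′ →
           WP popCell (setVar h′ $x k) (I k)
    step k h′ k<n _ (e , es , f) = wp-seq (wp-pop es (wp-seq (wp-put j≤N (wp-succ
      (trans (sym (+-suc _ k)) e , refl , filled)))))
      where
      j≤N : var h′ $j ≤ N
      j≤N = ≤-trans (subst (var h′ $j ≤_) e (m≤m+n _ _)) n≤N
      filled : ∀ i → i < suc (var h′ $j) → (arr h′ W [ var h′ $j ↦ c (var h′ $j) ]) i ≡ c i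
      filled i i<1+j with var h′ $j ≟ i
      ... | yes refl = update-same (arr h′ W) i _
      ... | no j≢i   = trans (update-other (arr h′ W) _ j≢i)
                             (f i (≤∧≢⇒< (≤-pred i<1+j) (≢-sym j≢i)))
    finish : ∀ h′ → Frame (loop $x popCell) (setVar h $j 0) h′ → I 0 h′ →
             stk h′ ≡ rest × (∀ i → i < n → arr h′ W i ≡ c i)
    finish h′ _ (e , es , f) = es , λ i i<n → f i (subst (i <_) (trans (sym e) (+-identityʳ _)) i<n)

  countDegree-spec : ∀ {h} → var h $u < n →
    WP countDegree h λ h′ → var h′ $deg ≡ degree (arr h W) (var h $u)
  countDegree-spec {h} u<n = wp-seq (wp-const (wp-loop I refl refl step finish))
    where
    f = neighbour (arr h W) (var h $u)
    I : ℕ → Store → Set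
    I k h′ = var h′ $deg + Σ< k f ≡ Σ< n f
    finish : ∀ h′ → Frame (loop $w countNeighbour) (setVar h $deg 0) h′ → I 0 h′ →
             var h′ $deg ≡ Σ< n f
    finish h′ _ e = trans (sym (+-identityʳ _)) e
    step : ∀ k h′ → k < n → Frame (loop $w countNeighbour) (setVar h $deg 0) h′ → I (suc k) h′ →
           WP countNeighbour (setVar h′ $w k) (I k)
    step k h′ k<n φ e with φ (variable′ $u) refl | φ (array W) refl
    ... | eu | eW = wp-seq (wp-entry (subst (_< n) (sym eu) u<n) k<n (wp-when
      (λ a≡0 → trans (Σ<-skip (var h′ $deg) f k
        (cong (λ a → guard a _) (trans (cong (λ u → A u k) (sym eu)) a≡0))) e)
      (λ a≢0 → wp-seq (wp-get (<n⇒≤N k<n) (wp-unless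
        (λ y≡0 → wp-succ (trans (Σ<-count (var h′ $deg) f k
          (guard-isZero≡1 (a≢0 ∘ trans (cong (λ u → A u k) eu))
                          (trans (cong (λ g → g k) (sym eW)) y≡0))) e))
        (λ y≢0 → trans (Σ<-skip (var h′ $deg) f k
          (guard-isZero≡0 (A (var h $u) k) (y≢0 ∘ trans (cong (λ g → g k) eW)))) e))))))

  MinDegree : Config → ℕ → Set
  MinDegree c v = v < n × c v ≡ 0 × (∀ u → u < n → c u ≡ 0 → degree c v ≤ degree c u)

  selectVertex-spec : ∀ {h} → WP selectVertex h λ h′ →
    (var h′ $found ≡ 0 × (∀ u → u < n → arr h W u ≢ 0)) ⊎
    (var h′ $found ≢ 0 × MinDegree (arr h W) (var h′ $v))
  selectVertex-spec {h} = wp-seq (wp-const (wp-seq (wp-vertexCount (wp-seq (wp-succ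
    (wp-loop I refl (inj₁ (refl , refl , λ u n≤u u<n → contradiction u<n (≤⇒≯ n≤u)))
      step finish))))))
    where
    c = arr h W
    I : ℕ → Store → Set
    I k h′ =
      (var h′ $found ≡ 0 × var h′ $best ≡ suc n × (∀ u → k ≤ u → u < n → c u ≢ 0)) ⊎
      (var h′ $found ≢ 0 × var h′ $v < n × c (var h′ $v) ≡ 0 ×
       var h′ $best ≡ degree c (var h′ $v) ×
       (∀ u → k ≤ u → u < n → c u ≡ 0 → degree c (var h′ $v) ≤ degree c u))
    h₀ = setVar (setVar (setVar h $found 0) $best n) $best (suc n)
    finish : ∀ h′ → Frame (loop $u considerVertex) h₀ h′ → I 0 h′ →
             (var h′ $found ≡ 0 × (∀ u → u < n → c u ≢ 0)) ⊎
             (var h′ $found ≢ 0 × MinDegree c (var h′ $v))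
    finish h′ _ (inj₁ (e , _ , f)) = inj₁ (e , λ u → f u z≤n)
    finish h′ _ (inj₂ (e , p , q , _ , f)) = inj₂ (e , p , q , λ u → f u z≤n)
    extend : ∀ {k} {P : ℕ → Set} → P k → (∀ u → suc k ≤ u → u < n → P u) →
             ∀ u → k ≤ u → u < n → P u
    extend p f u k≤u u<n with m≤n⇒m<n∨m≡n k≤u
    ... | inj₁ k<u  = f u k<u u<n
    ... | inj₂ refl = p
    step : ∀ k h′ → k < n → Frame (loop $u considerVertex) h₀ h′ → I (suc k) h′ →
           WP considerVertex (setVar h′ $u k) (I k)
    step k h′ k<n φ i = wp-seq (wp-get (<n⇒≤N k<n) (wp-unless
      (λ y≡0 → countDegree-spec k<n »» λ h″ φ″ e →
        wp-seq (wp-monus (≤-trans (≤-trans (≤-reflexive e) (degree≤n _ k)) n≤N) (wp-when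
          (λ d≡0 → keep y≡0 h″ φ″ e d≡0 i)
          (λ d≢0 → wp-seq (wp-copy (wp-seq (wp-copy (wp-const (improve y≡0 h″ φ″ e d≢0 i)))))))))
      (λ y≢0 → ignore y≢0 i)))
      where
      eW : arr h′ W ≡ c
      eW = φ (array W) refl
      ignore : arr h′ W k ≢ 0 → I (suc k) h′ → I k (setVar (setVar h′ $u k) $y (arr h′ W k))
      ignore y≢0 (inj₁ (a , b , f)) = inj₁ (a , b , extend (y≢0 ∘ trans (cong (λ g → g k) eW)) f)
      ignore y≢0 (inj₂ (a , b , c , d , f)) =
        inj₂ (a , b , c , d , extend (λ e → contradiction (trans (cong (λ g → g k) eW) e) y≢0) f)
      module _ (y≡0 : arr h′ W k ≡ 0) (h″ : Store)
               (φ″ : Frame countDegree (setVar (setVar h′ $u k) $y (arr h′ W k)) h″)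
               (e : var h″ $deg ≡ degree (arr h′ W) k) where
        degk : var h″ $deg ≡ degree c k
        degk = trans e (cong (λ g → degree g k) eW)
        ck : c k ≡ 0
        ck = trans (sym (cong (λ g → g k) eW)) y≡0
        eb : var h″ $best ≡ var h′ $best
        eb = φ″ (variable′ $best) refl
        h₁ : Store
        h₁ = setVar h″ $d (var h″ $best ∸ var h″ $deg)
        keep : var h″ $best ∸ var h″ $deg ≡ 0 → I (suc k) h′ → I k h₁
        -- As long as no vertex is found, `$best` is n + 1 and no degree reaches it.
        keep d≡0 (inj₁ (_ , b , _)) = contradiction
          (≤-trans (subst₂ _≤_ (trans eb b) degk (m∸n≡0⇒m≤n d≡0)) (degree≤n c k)) 1+n≰n
        keep d≡0 (inj₂ (a , b , cv , d , f)) rewrite φ″ (variable′ $v) refl = inj₂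
          ( a ∘ trans (sym (φ″ (variable′ $found) refl)) , b , cv , trans eb d
          , extend (λ _ → subst₂ _≤_ (trans eb d) degk (m∸n≡0⇒m≤n d≡0)) f)
        improve : var h″ $best ∸ var h″ $deg ≢ 0 → I (suc k) h′ →
                  I k (setVar (setVar (setVar h₁ $best (var h″ $deg)) $v (var h″ $u)) $found 1)
        improve d≢0 i rewrite φ″ (variable′ $u) refl =
          inj₂ ((λ ()) , k<n , ck , degk , extend (λ _ → ≤-refl) (below i))
          where
          below : I (suc k) h′ → ∀ u → suc k ≤ u → u < n → c u ≡ 0 → degree c k ≤ degree c u
          below (inj₁ (_ , _ , f)) u k<u u<n cu = contradiction cu (f u k<u u<n)
          below (inj₂ (_ , _ , _ , d , f)) u k<u u<n cu = ≤-trans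
            (subst₂ _≤_ degk (trans eb d) (<⇒≤ (≰⇒> (d≢0 ∘ m≤n⇒m∸n≡0)))) (f u k<u u<n cu)

  pushChild-spec : ∀ {h} → var h $z < n →
    WP pushChild h λ h′ → stk h′ ≡ seg (child (arr h W) (var h $z)) 0 n (stk h) ×
                          var h′ $cnt ≡ suc (var h $cnt)
  pushChild-spec {h} z<n = wp-loop I refl (0 , +-identityʳ n , refl) step
      (λ h′ φ (j , e , es) →
        trans es (cong (λ j → seg ch 0 j (stk h)) e) , φ (variable′ $cnt) refl) »»
    λ h′ φ (e , e′) → wp-succ (e , cong suc e′)
    where
    ch = child (arr h W) (var h $z)
    I : ℕ → Store → Set
    I k h′ = ∃ λ j → k + j ≡ n × stk h′ ≡ seg ch k j (stk h)
    step : ∀ k h′ → k < n → Frame (loop $w pushChildCell) h h′ → I (suc k) h′ →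
           WP pushChildCell (setVar h′ $w k) (I k)
    step k h′ k<n φ (j , e , es) = wp-seq (wp-get (<n⇒≤N k<n) (marked »» λ h₁ φ₁ e₁ →
      wp-seq (wp-distance refl refl (<n⇒≤N (k₁ φ₁)) (<n⇒≤N (z₁ φ₁)) λ h₂ φ₂ _ to from →
        wp-unless-join
          (λ d≡0 → suc j , trans (+-suc k j) e , cong₂ _∷_
            (sym (if-cong (dec-true (k ≟ var h $z)
              (trans (sym (φ₁ (variable′ $w) refl)) (trans (to d≡0) (same-z φ₁))))))
            (same-stack φ₁ φ₂))
          (λ d≢0 → suc j , trans (+-suc k j) e , cong₂ _∷_
            (trans (trans (φ₂ (variable′ $y) refl) e₁)
              (sym (if-cong (dec-false (k ≟ var h $z) λ k≡z → d≢0 (from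
                (trans (φ₁ (variable′ $w) refl) (trans k≡z (sym (same-z φ₁)))))))))
            (same-stack φ₁ φ₂)))))
      where
      h₀ : Store
      h₀ = setVar (setVar h′ $w k) $y (arr h′ W k)
      ez : var h′ $z ≡ var h $z
      ez = φ (variable′ $z) refl
      eW : arr h′ W k ≡ arr h W k
      eW = cong (λ g → g k) (φ (array W) refl)
      marker : Command
      marker = unless $y (entry $a $z $w » when $a (const $y 2))
      marked : WP marker h₀ λ h₁ → var h₁ $y ≡ mark (arr h W k) (A (var h $z) k)
      marked = wp-unless
        (λ y≡0 → wp-seq (wp-entry (subst (_< n) (sym ez) z<n) k<n (wp-when
          (λ a≡0 → trans y≡0 (sym (cong₂ mark (trans (sym eW) y≡0)
            (trans (cong (λ z → A z k) (sym ez)) a≡0))))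
          (λ a≢0 → wp-const (sym (trans (cong (λ x → mark x _) (trans (sym eW) y≡0))
            (mark-0 (a≢0 ∘ trans (cong (λ z → A z k) ez)))))))))
        (λ y≢0 → trans eW (sym (mark-≢0 (y≢0 ∘ trans eW))))
        where
        mark-0 : ∀ {a} → a ≢ 0 → mark 0 a ≡ 2
        mark-0 {zero}  a≢0 = contradiction refl a≢0
        mark-0 {suc _} _   = refl
        mark-≢0 : ∀ {x a} → x ≢ 0 → mark x a ≡ x
        mark-≢0 {zero}  x≢0 = contradiction refl x≢0
        mark-≢0 {suc _} _   = refl
      if-cong : ∀ {b b′} → b ≡ b′ → (if b then 1 else mark (arr h W k) (A (var h $z) k)) ≡
                                    (if b′ then 1 else mark (arr h W k) (A (var h $z) k))
      if-cong = cong (if_then 1 else mark (arr h W k) (A (var h $z) k))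
      same-z : ∀ {h₁} → Frame marker h₀ h₁ → var h₁ $z ≡ var h $z
      same-z φ₁ = trans (φ₁ (variable′ $z) refl) ez
      k₁ : ∀ {h₁} → Frame marker h₀ h₁ → var h₁ $w < n
      k₁ φ₁ = subst (_< n) (sym (φ₁ (variable′ $w) refl)) k<n
      z₁ : ∀ {h₁} → Frame marker h₀ h₁ → var h₁ $z < n
      z₁ φ₁ = subst (_< n) (sym (same-z φ₁)) z<n
      same-stack : ∀ {h₁ h₂} → Frame marker h₀ h₁ → Frame (distance $d $w $z) h₁ h₂ →
                   stk h₂ ≡ seg ch (suc k) j (stk h)
      same-stack φ₁ φ₂ = trans (φ₂ stack refl) (trans (φ₁ stack refl) es)
      wp-unless-join : ∀ {h₂ Q} → (var h₂ $d ≡ 0 → Q (setStack (setVar h₂ $y 1) (1 ∷ stk h₂))) →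
        (var h₂ $d ≢ 0 → Q (setStack h₂ (var h₂ $y ∷ stk h₂))) →
        WP (unless $d (const $y 1) » push $y) h₂ Q
      wp-unless-join f g =
        wp-seq (wp-unless (λ e → wp-const (wp-push (f e))) (λ ne → wp-push (g ne)))

  children : Config → List ℕ → List ℕ → List ℕ
  children c zs rest = foldr (λ z → seg (child c z) 0 n) rest zs

  -- What the search needs of the branching vertices: the exact length for the count of leaves,
  -- `free` for progress and validity, `self` and `all` for completeness.
  record Branching (c : Config) (v : ℕ) (zs : List ℕ) : Set where
    field
      length≡  : length zs ≡ suc (degree c v)
      free     : All (λ z → z < n × c z ≡ 0) zs
      self     : v List.∈ zs
      all      : ∀ u → u < n → A v u ≢ 0 → c u ≡ 0 → u List.∈ zs

  pushChildren-spec : ∀ {h} → MinDegree (arr h W) (var h $v) →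
    WP pushChildren h λ h′ → ∃ λ zs → Branching (arr h W) (var h $v) zs ×
      stk h′ ≡ children (arr h W) zs (stk h) × var h′ $cnt ≡ length zs + var h $cnt
  pushChildren-spec {h} (v<n , cv , _) =
    wp-loop I refl
      (record { length+ = refl ; free = [] ; all = λ u n≤u u<n → contradiction u<n (≤⇒≯ n≤u)
              ; stk≡ = refl ; cnt≡ = refl })
      step (λ h′ φ i → φ , i) »»
    λ h₁ _ (φ , i) → let open I i in wp-seq (wp-copy (wp-weaken
      (λ h₂ φ₂ (e , e′) → var h $v ∷ zs ,
        record { length≡ = cong suc (trans (sym (+-identityʳ _)) length+)
               ; free = (v<n , cv) ∷ free ; self = here refl
               ; all = λ u u<n a cu → there (all u z≤n u<n a cu) } ,
        trans e (cong₂ (λ c s → seg c 0 n s)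
          (cong₂ child (φ (array W) refl) (φ (variable′ $v) refl)) stk≡) ,
        trans e′ (cong suc cnt≡))
      (pushChild-spec (subst (_< n) (sym (φ (variable′ $v) refl)) v<n))))
    where
    c = arr h W
    f = neighbour c (var h $v)
    record I (k : ℕ) (h′ : Store) : Set where
      field
        {zs}    : List ℕ
        length+ : length zs + Σ< k f ≡ Σ< n f
        free    : All (λ z → z < n × c z ≡ 0) zs
        all     : ∀ u → k ≤ u → u < n → A (var h $v) u ≢ 0 → c u ≡ 0 → u List.∈ zs
        stk≡    : stk h′ ≡ children c zs (stk h)
        cnt≡    : var h′ $cnt ≡ length zs + var h $cnt
    step : ∀ k h′ → k < n → Frame (loop $u pushChildAt) h h′ → I (suc k) h′ →
           WP pushChildAt (setVar h′ $u k) (I k)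
    step k h′ k<n φ i = wp-seq (wp-entry (subst (_< n) (sym ev) v<n) k<n (wp-when
      (λ a≡0 → ignore (λ _ a≢0 _ → contradiction (trans (cong (λ v → A v k) (sym ev)) a≡0) a≢0)
        (cong (λ a → guard a (isZero (c k))) (trans (cong (λ v → A v k) (sym ev)) a≡0)) refl refl)
      (λ a≢0 → wp-seq (wp-get (<n⇒≤N k<n) (wp-unless
        (λ y≡0 → wp-seq (wp-copy (wp-weaken
          (λ h₁ φ₁ (e , e′) → record
            { zs = k ∷ zs
            ; length+ = trans (Σ<-count (length zs) f k (guard-isZero≡1
                (a≢0 ∘ trans (cong (λ v → A v k) ev)) (trans (sym (eW k)) y≡0))) length+
            ; free = (k<n , trans (sym (eW k)) y≡0) ∷ free
            ; all = λ u k≤u u<n a cu →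
                extend k≤u (λ k<u → there (all u k<u u<n a cu)) λ e → here (sym e)
            ; stk≡ = trans e (cong₂ (λ g s → seg (child g k) 0 n s) (φ (array W) refl) stk≡)
            ; cnt≡ = trans e′ (cong suc cnt≡) })
          (pushChild-spec k<n))))
        (λ y≢0 → ignore (λ _ _ cu → contradiction (trans (eW k) cu) y≢0)
          (guard-isZero≡0 (A (var h $v) k) (y≢0 ∘ trans (eW k))) refl refl))))))
      where
      open I i
      ev : var h′ $v ≡ var h $v
      ev = φ (variable′ $v) refl
      eW : ∀ k → arr h′ W k ≡ c k
      eW k = cong (λ g → g k) (φ (array W) refl)
      extend : ∀ {u} {P : Set} → k ≤ u → (k < u → P) → (k ≡ u → P) → P
      extend k≤u f g with m≤n⇒m<n∨m≡n k≤u
      ... | inj₁ k<u = f k<u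
      ... | inj₂ e   = g e
      ignore : ∀ {h″} → (k < n → A (var h $v) k ≢ 0 → c k ≡ 0 → k List.∈ zs) → f k ≡ 0 →
               stk h″ ≡ stk h′ → var h″ $cnt ≡ var h′ $cnt → I k h″
      ignore p z e e′ = record
        { zs = zs
        ; length+ = trans (Σ<-skip (length zs) f k z) length+
        ; free = free
        ; all = λ u k≤u u<n a cu →
            extend k≤u (λ k<u → all u k<u u<n a cu) λ { refl → p u<n a cu }
        ; stk≡ = trans e stk≡
        ; cnt≡ = trans e′ cnt≡ }

  pushRoot-spec : ∀ {h} → stk h ≡ [] → WP pushRoot h λ h′ →
    stk h′ ≡ seg (λ _ → 0) 0 n [] × var h′ $cnt ≡ 1 × var h′ $ans ≡ var h $ans
  pushRoot-spec {h} e = wp-seq (wp-const (wp-loop I refl (0 , +-identityʳ n , e) step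
      (λ h′ φ (j , e , es) →
        trans es (cong (λ j → seg (λ _ → 0) 0 j []) e) , φ (variable′ $ans) refl) »»
    λ h′ φ (e , e′) → wp-const (e , refl , e′)))
    where
    I : ℕ → Store → Set
    I k h′ = ∃ λ j → k + j ≡ n × stk h′ ≡ seg (λ _ → 0) k j []
    step : ∀ k h′ → k < n → Frame (loop $w (push $y)) (setVar h $y 0) h′ → I (suc k) h′ →
           WP (push $y) (setVar h′ $w k) (I k)
    step k h′ k<n φ (j , e , es) =
      wp-push (suc j , trans (+-suc k j) e , cong₂ _∷_ (φ (variable′ $y) refl) es)

index : ∀ {n k} → k < n → ∃ λ (i : Fin n) → k ≡ toℕ i
index k<n = fromℕ< k<n , sym (toℕ-fromℕ< k<n)

chosen : ∀ {n} → Config → Subset n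
chosen c = Vec.tabulate λ i → does (c (toℕ i) ≟ 1)

chosen⁺ : ∀ {n} c {i : Fin n} → c (toℕ i) ≡ 1 → i ∈ chosen c
chosen⁺ c {i} e = lookup⇒[]= i (chosen c) (trans (lookup∘tabulate _ i) (dec-true (c (toℕ i) ≟ 1) e))

chosen⁻ : ∀ {n} c {i : Fin n} → i ∈ chosen c → c (toℕ i) ≡ 1
chosen⁻ c {i} i∈ = ≡ᵇ⇒≡ (c (toℕ i)) 1 (subst T (sym
  (trans (sym (lookup∘tabulate (λ i → does (c (toℕ i) ≟ 1)) i)) ([]=⇒lookup i∈))) tt)

-- Testing connectivity at a leaf

redirect : ℕ → ℕ → ℕ → ℕ
redirect p q y = if does (y ≟ p) then q else y

redirect-≡ : ∀ {p q y} → y ≡ p → redirect p q y ≡ q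
redirect-≡ {p} {q} {y} e = cong (if_then q else y) (dec-true (y ≟ p) e)

redirect-≢ : ∀ {p q y} → y ≢ p → redirect p q y ≡ y
redirect-≢ {p} {q} {y} e = cong (if_then q else y) (dec-false (y ≟ p) e)

redirect-bound : ∀ {p q y b} → y ≤ b → q ≤ b → redirect p q y ≤ b
redirect-bound {p} {q} {y} y≤b q≤b with y ≟ p
... | yes e = subst (_≤ _) (sym (redirect-≡ e)) q≤b
... | no ne = subst (_≤ _) (sym (redirect-≢ ne)) y≤b

module LeafTest
  (n N : ℕ) (n≤N : n ≤ N) (G : Graph n) (A : ℕ → ℕ → ℕ)
  (A≢0⇒adj : ∀ i j → A (toℕ i) (toℕ j) ≢ 0 → Adj G i j)
  (adj⇒A≢0 : ∀ i j → Adj G i j → A (toℕ i) (toℕ j) ≢ 0) where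

  open Search n N n≤N A public

  module _ {c : Command} {h : Store} {Q : Store → Set} (I : ℕ → ℕ → Store → Set) where

    private Nested = loop $u (loop $w c)

    -- I k l holds once all pairs lexicographically from (k , l) on are processed.
    wp-pairs : touches c (variable′ $u) ≡ false → touches c (variable′ $w) ≡ false →
      (∀ {k l h′} x → I k l h′ → I k l (setVar h′ $u x)) →
      (∀ {k l h′} x → I k l h′ → I k l (setVar h′ $w x)) →
      (∀ {k h′} → I (suc k) 0 h′ → I k n h′) →
      I n 0 h →
      (∀ k l h′ → k < n → l < n → Frame Nested h h′ → var h′ $u ≡ k → var h′ $w ≡ l →
        I k (suc l) h′ → WP c h′ (I k l)) →
      (∀ h′ → Frame Nested h h′ → I 0 0 h′ → Q h′) →
      WP Nested h Q
    wp-pairs fu fw su sw wrap start step finish = wp-loop (λ k → I k 0) fu (su n start)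
      (λ k h′ k<n φ i → wp-loop (λ l h″ → var h″ $u ≡ k × I k l h″) fw (refl , sw n (su k (wrap i)))
        (λ l h″ l<n φ″ (e , i″) → wp-weaken
          (λ h‴ φ‴ i‴ → trans (φ‴ (variable′ $u) fu) e , i‴)
          (step k l (setVar h″ $w l) k<n l<n (frame {k} {l} φ φ″) e refl (sw l i″)))
        (λ h″ φ″ (e , i″) → i″))
      finish
      where
      frame : ∀ {k l h′ h″} → Frame Nested h h′ → Frame (loop $w c) (setVar h′ $u k) h″ →
              Frame Nested h (setVar h″ $w l)
      frame {k} {l} {h′} {h″} φ φ″ r e = trans
        (setVar-unchanged {h″} $w {l} r (∨-falseˡ (∨-falseʳ {variable′ $u ≡ᶜ r} e)))
        (trans (φ″ r (∨-falseʳ {variable′ $u ≡ᶜ r} e))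
        (trans (setVar-unchanged {h′} $u {k} r (∨-falseˡ e)) (φ r e)))

  module _ (c : Config) where

    S : Subset n
    S = chosen c

    -- Soundness holds throughout, completeness only for the pairs in `Done`; once these are all
    -- pairs, the label classes outside `S` are the components of G - S. Labels must be `bounded`
    -- because comparing two of them takes a loop of that length.
    record Labelling (Done : Fin n → Fin n → Set) (f : ℕ → ℕ) : Set where
      field
        bounded  : ∀ i → i < n → f i ≤ N
        sound    : ∀ {i j} → i ∉ S → j ∉ S → f (toℕ i) ≡ f (toℕ j) → Star (AdjAvoiding G S) i j
        complete : ∀ {i j} → Done i j → AdjAvoiding G S i j → f (toℕ i) ≡ f (toℕ j)
    open Labelling

    AdjAvoiding-sym : ∀ {i j} → AdjAvoiding G S i j → AdjAvoiding G S j i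
    AdjAvoiding-sym (p , q , a) = q , p , Graph.sym G a

    labelling-init : ∀ {Done} {f : ℕ → ℕ} → (∀ i → i < n → f i ≡ i) → (∀ {i j} → ¬ Done i j) →
                     Labelling Done f
    labelling-init {f = f} e ¬d = record
      { bounded  = λ i i<n → subst (_≤ N) (sym (e i i<n)) (<n⇒≤N i<n)
      ; sound    = λ {i} {j} _ _ p → subst (Star (AdjAvoiding G S) i)
          (toℕ-injective (trans (sym (e _ (toℕ<n i))) (trans p (e _ (toℕ<n j))))) ε
      ; complete = λ d → contradiction d ¬d
      }

    labelling-skip : ∀ {Done Done′ f} →
      (∀ {i j} → Done′ i j → AdjAvoiding G S i j → Done i j) →
      Labelling Done f → Labelling Done′ f
    labelling-skip g l = record
      { bounded = bounded l ; sound = sound l ; complete = λ d e → complete l (g d e) e }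

    -- The new label of a vertex depends only on its old label, so equalities gained earlier are
    -- never lost. That is why a single pass over the pairs suffices.
    labelling-merge : ∀ {Done Done′ f f′ u w} → AdjAvoiding G S u w →
      (∀ i → i < n → f′ i ≡ redirect (f (toℕ u)) (f (toℕ w)) (f i)) →
      (∀ {i j} → Done′ i j → Done i j ⊎ (i ≡ u × j ≡ w)) →
      Labelling Done f → Labelling Done′ f′
    labelling-merge {Done} {Done′} {f} {f′} {u} {w} uw@(u∉ , w∉ , _) e g l = record
      { bounded  = λ i i<n → subst (_≤ N) (sym (e i i<n))
                     (redirect-bound (bounded l i i<n) (bounded l _ (toℕ<n w)))
      ; sound    = λ {i} {j} p q eq → sound′ p q (trans (sym (at i)) (trans eq (at j)))
      ; complete = λ d a → trans (at _) (trans (complete′ (g d) a) (sym (at _)))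
      }
      where
      P Q : ℕ
      P = f (toℕ u)
      Q = f (toℕ w)
      at : ∀ i → f′ (toℕ i) ≡ redirect P Q (f (toℕ i))
      at i = e (toℕ i) (toℕ<n i)
      -- Every vertex outside S is joined to one that had its new label before.
      source : ∀ {i} → i ∉ S → ∃ λ i′ → i′ ∉ S × Star (AdjAvoiding G S) i i′ ×
                                        f (toℕ i′) ≡ redirect P Q (f (toℕ i))
      source {i} i∉ with f (toℕ i) ≟ P
      ... | yes p = w , w∉ , sound l i∉ u∉ p ◅◅ (uw ◅ ε) , sym (redirect-≡ p)
      ... | no ¬p = i , i∉ , ε , sym (redirect-≢ ¬p)
      sound′ : ∀ {i j} → i ∉ S → j ∉ S →
               redirect P Q (f (toℕ i)) ≡ redirect P Q (f (toℕ j)) → Star (AdjAvoiding G S) i j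
      sound′ i∉ j∉ eq with source i∉ | source j∉
      ... | i′ , i′∉ , s , p | j′ , j′∉ , t , q =
        s ◅◅ sound l i′∉ j′∉ (trans p (trans eq (sym q))) ◅◅ Star.reverse AdjAvoiding-sym t
      complete′ : ∀ {i j} → Done i j ⊎ (i ≡ u × j ≡ w) → AdjAvoiding G S i j →
                  redirect P Q (f (toℕ i)) ≡ redirect P Q (f (toℕ j))
      complete′ (inj₁ d) a = cong (redirect P Q) (complete l d a)
      -- Both ends receive the label `Q`, also in the case that `Q` was already `P`.
      complete′ (inj₂ (refl , refl)) a with Q ≟ P
      ... | yes p = trans (redirect-≡ {P} {Q} {P} refl) (sym (redirect-≡ p))
      ... | no ¬p = trans (redirect-≡ {P} {Q} {P} refl) (sym (redirect-≢ ¬p))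

    connected-labels : ∀ {f : ℕ → ℕ} {i j} →
                       (∀ {i j} → AdjAvoiding G S i j → f (toℕ i) ≡ f (toℕ j)) →
                       Star (AdjAvoiding G S) i j → f (toℕ i) ≡ f (toℕ j)
    connected-labels e ε        = refl
    connected-labels {f} e (a ◅ as) = trans (e a) (connected-labels {f} e as)

    From : ℕ → ℕ → Fin n → Fin n → Set
    From k l i j = k < toℕ i ⊎ (k ≡ toℕ i × l ≤ toℕ j)

    -- Second components are below `n`, so the positions (k , n) and (k + 1 , 0) leave the same
    -- pairs processed.
    from-wrap : ∀ {k i j} → From k n i j → From (suc k) 0 i j
    from-wrap (inj₁ k<i) with m≤n⇒m<n∨m≡n k<i
    ... | inj₁ k<i = inj₁ k<i
    ... | inj₂ e   = inj₂ (e , z≤n)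
    from-wrap {j = j} (inj₂ (_ , n≤j)) = contradiction (toℕ<n j) (≤⇒≯ n≤j)

    from-split : ∀ {k l i j} → From k l i j → From k (suc l) i j ⊎ (k ≡ toℕ i × l ≡ toℕ j)
    from-split (inj₁ k<i) = inj₁ (inj₁ k<i)
    from-split (inj₂ (e , l≤j)) with m≤n⇒m<n∨m≡n l≤j
    ... | inj₁ l<j = inj₁ (inj₂ (e , l<j))
    ... | inj₂ e′  = inj₂ (e , e′)

    from-empty : ∀ {i j} → ¬ From n 0 i j
    from-empty {i} (inj₁ n<i)     = <-asym n<i (toℕ<n i)
    from-empty {i} (inj₂ (e , _)) = <⇒≢ (toℕ<n i) (sym e)

    from-all : ∀ {i j} → From 0 0 i j
    from-all {i} with m≤n⇒m<n∨m≡n (z≤n {toℕ i})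
    ... | inj₁ p = inj₁ p
    ... | inj₂ e = inj₂ (e , z≤n)

    module _ (c≢0 : ∀ i → i < n → c i ≢ 0) where

      pred≡0 : ∀ {i} → i < n → pred (c i) ≡ 0 → c i ≡ 1
      pred≡0 {i} i<n e with c i | c≢0 i i<n
      ... | zero        | ne = contradiction refl ne
      ... | suc zero    | _  = refl

      wp-outside : ∀ {x d h Q} → arr h W ≡ c → (i : Fin n) → var h x ≡ toℕ i → ($y ≡ᵇ x) ≡ false →
        (i ∈ S → Q (setVar (setVar h $y (c (toℕ i))) $y (pred (c (toℕ i))))) →
        (i ∉ S → WP d (setVar (setVar h $y (c (toℕ i))) $y (pred (c (toℕ i)))) Q) →
        WP (outside x d) h Q
      wp-outside {x} {d} {h} {Q} refl i e y≢x f g =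
        wp-seq (wp-get (subst (_≤ N) (sym e) (<n⇒≤N (toℕ<n i)))
        (subst (λ k → WP (prec $y $y » when $y d) (setVar h $y (arr h W k)) Q) (sym e)
          (wp-seq (wp-prec (wp-when
            (λ p → f (chosen⁺ c (pred≡0 (toℕ<n i) p)))
            (λ p → g λ i∈ → p (cong pred (chosen⁻ c i∈))))))))

      initLabels-spec : ∀ {h} → WP initLabels h λ h′ → ∀ i → i < n → arr h′ L i ≡ i
      initLabels-spec = wp-loop (λ k h′ → ∀ i → k ≤ i → i < n → arr h′ L i ≡ i) refl
        (λ i n≤i i<n → contradiction i<n (≤⇒≯ n≤i))
        (λ k h′ k<n φ f → wp-put (<n⇒≤N k<n) (set {f = arr h′ L} f))
        (λ h′ φ f i → f i z≤n)
        where
        set : ∀ {k f} → (∀ i → suc k ≤ i → i < n → f i ≡ i) →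
              ∀ i → k ≤ i → i < n → (f [ k ↦ k ]) i ≡ i
        set {k} {f} p i k≤i i<n with k ≟ i
        ... | yes refl = update-same f k k
        ... | no k≢i   = trans (update-other f k k≢i) (p i (≤∧≢⇒< k≤i k≢i) i<n)

      relabelCell : Command
      relabelCell = get $y L $x » distance $d $y $p » unless $d (put L $x $q)

      relabel-spec : ∀ {h} → (∀ i → i < n → arr h L i ≤ N) → var h $p ≤ N →
        WP relabel h λ h′ → ∀ i → i < n → arr h′ L i ≡ redirect (var h $p) (var h $q) (arr h L i)
      relabel-spec {h} bd p≤N = wp-loop I refl
        ((λ i n≤i i<n → contradiction i<n (≤⇒≯ n≤i)) , λ _ _ → refl)
        step (λ h′ φ (f , _) i → f i z≤n)
        where
        r = redirect (var h $p) (var h $q)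
        I : ℕ → Store → Set
        I k h′ = (∀ i → k ≤ i → i < n → arr h′ L i ≡ r (arr h L i)) ×
                 -- The cells still to come hold their original labels, so the test at each cell is
                 -- against its label in `h`.
                 (∀ i → i < k → arr h′ L i ≡ arr h L i)
        step : ∀ k h′ → k < n → Frame (loop $x relabelCell) h h′ → I (suc k) h′ →
               WP relabelCell (setVar h′ $x k) (I k)
        step k h′ k<n φ (f , g) = wp-seq (wp-get (<n⇒≤N k<n) (wp-seq (wp-distance refl refl
            (subst (_≤ N) (sym gk) (bd k k<n)) (subst (_≤ N) (sym ep) p≤N)
            λ h″ φ″ eA to from → wp-unless
              (λ d≡0 → wp-put (subst (_≤ N) (sym (φ″ (variable′ $x) refl)) (<n⇒≤N k<n))
                (subst₂ (λ a x → I k (setCell (record h″ { arr = a }) L x (var h″ $q)))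
                  (sym eA) (sym (φ″ (variable′ $x) refl))
                  (hit (trans (φ″ (variable′ $q) refl) (φ (variable′ $q) refl))
                       (trans (sym gk) (trans (to d≡0) ep)))))
              (λ d≢0 → subst (λ a → I k (record h″ { arr = a })) (sym eA)
                (miss λ e → d≢0 (from (trans gk (trans e (sym ep)))))))))
          where
          gk : arr h′ L k ≡ arr h L k
          gk = g k ≤-refl
          ep : var h′ $p ≡ var h $p
          ep = φ (variable′ $p) refl
          hit : ∀ {q} → q ≡ var h $q → arr h L k ≡ var h $p →
                (∀ i → k ≤ i → i < n → (arr h′ L [ k ↦ q ]) i ≡ r (arr h L i)) ×
                (∀ i → i < k → (arr h′ L [ k ↦ q ]) i ≡ arr h L i)
          hit {q} refl e = f′ , λ i i<k →
            trans (update-other (arr h′ L) q (≢-sym (<⇒≢ i<k))) (g i (m<n⇒m<1+n i<k))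
            where
            f′ : ∀ i → k ≤ i → i < n → (arr h′ L [ k ↦ q ]) i ≡ r (arr h L i)
            f′ i k≤i i<n with k ≟ i
            ... | yes refl = trans (update-same (arr h′ L) k q) (sym (redirect-≡ e))
            ... | no k≢i   = trans (update-other (arr h′ L) q k≢i) (f i (≤∧≢⇒< k≤i k≢i) i<n)
          miss : arr h L k ≢ var h $p →
                (∀ i → k ≤ i → i < n → arr h′ L i ≡ r (arr h L i)) ×
                (∀ i → i < k → arr h′ L i ≡ arr h L i)
          miss ne = f′ , λ i i<k → g i (m<n⇒m<1+n i<k)
            where
            f′ : ∀ i → k ≤ i → i < n → arr h′ L i ≡ r (arr h L i)
            f′ i k≤i i<n with k ≟ i
            ... | yes refl = trans gk (sym (redirect-≢ ne))
            ... | no k≢i   = f i (≤∧≢⇒< k≤i k≢i) i<n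

      mergePair comparePair : Command
      mergePair = entry $a $u $w » when $a (outside $u (outside $w (
        get $p L $u » get $q L $w » relabel)))
      comparePair = outside $u (outside $w (
        get $p L $u » get $q L $w » distance $d $p $q » when $d (const $ans 1)))

      mergeLabels-spec : ∀ {h} → arr h W ≡ c → (∀ i → i < n → arr h L i ≡ i) →
        WP mergeLabels h λ h′ → Labelling (From 0 0) (arr h′ L)
      mergeLabels-spec {h} eW init = wp-pairs I refl refl (λ _ i → i) (λ _ i → i)
        (labelling-skip λ d _ → from-wrap d) (labelling-init init from-empty) step (λ _ _ i → i)
        where
        I : ℕ → ℕ → Store → Set
        I k l h′ = Labelling (From k l) (arr h′ L)
        step : ∀ k l h′ → k < n → l < n → Frame mergeLabels h h′ → var h′ $u ≡ k → var h′ $w ≡ l →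
               I k (suc l) h′ → WP mergePair h′ (I k l)
        step k l h′ k<n l<n φ ek el lab with index k<n | index l<n
        ... | u , refl | w , refl =
          wp-seq (wp-entry (subst (_< n) (sym ek) k<n) (subst (_< n) (sym el) l<n) (wp-when
            (λ a≡0 → ignore λ (_ , _ , a) → adj⇒A≢0 u w a (trans (sym eA) a≡0))
            (λ a≢0 → wp-outside (trans (φ (array W) refl) eW) u ek refl
              (λ u∈ → ignore λ (u∉ , _) → u∉ u∈)
              (λ u∉ → wp-outside (trans (φ (array W) refl) eW) w el refl
                (λ w∈ → ignore λ (_ , w∉ , _) → w∉ w∈)
                (λ w∉ → wp-seq (wp-get (subst (_≤ N) (sym ek) (<n⇒≤N k<n))
                  (wp-seq (wp-get (subst (_≤ N) (sym el) (<n⇒≤N l<n)) (wp-weaken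
                    (λ h″ φ″ f → labelling-merge (u∉ , w∉ , A≢0⇒adj u w (a≢0 ∘ trans eA))
                      (λ i i<n → trans (f i i<n)
                        (cong₂ (λ x y → redirect (arr h′ L x) (arr h′ L y) (arr h′ L i)) ek el))
                      split lab)
                    (relabel-spec (bounded lab)
                      (subst (λ x → arr h′ L x ≤ N) (sym ek) (bounded lab _ k<n))))))))))))
          where
          eA : A (var h′ $u) (var h′ $w) ≡ A (toℕ u) (toℕ w)
          eA = cong₂ A ek el
          split : ∀ {i j} → From (toℕ u) (toℕ w) i j →
                  From (toℕ u) (suc (toℕ w)) i j ⊎ (i ≡ u × j ≡ w)
          split d with from-split d
          ... | inj₁ d′        = inj₁ d′
          ... | inj₂ (e , e′)  = inj₂ (toℕ-injective (sym e) , toℕ-injective (sym e′))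
          ignore : ¬ AdjAvoiding G S u w → Labelling (From (toℕ u) (toℕ w)) (arr h′ L)
          ignore ne = labelling-skip g lab
            where
            g : ∀ {i j} → From (toℕ u) (toℕ w) i j → AdjAvoiding G S i j →
                From (toℕ u) (suc (toℕ w)) i j
            g d a with split d
            ... | inj₁ d′            = d′
            ... | inj₂ (refl , refl) = contradiction a ne

      -- `$ans` accumulates over all leaves and is never reset, so the verdict is relative to its
      -- earlier value.
      LeafVerdict : Store → Store → Set
      LeafVerdict h h′ =
        (var h $ans ≡ 1 → var h′ $ans ≡ 1) ×
        (var h′ $ans ≡ 1 → var h $ans ≡ 1 ⊎ IsCutset G S) ×
        (IsCutset G S → var h′ $ans ≡ 1)

      compareLabels-spec : ∀ {h} → arr h W ≡ c → Labelling (From 0 0) (arr h L) →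
        WP compareLabels h (LeafVerdict h)
      compareLabels-spec {h} eW lab = wp-pairs I refl refl (λ _ i → i) (λ _ i → i)
          (λ (p , q , r) → p , q , λ d → r (from-wrap d))
          (id , inj₁ , λ d → contradiction d from-empty)
          step (λ h′ _ (p , q , r) → p , q , finish h′ r)
        where
        f : ℕ → ℕ
        f = arr h L
        I : ℕ → ℕ → Store → Set
        I k l h′ =
          (var h $ans ≡ 1 → var h′ $ans ≡ 1) ×
          (var h′ $ans ≡ 1 → var h $ans ≡ 1 ⊎ IsCutset G S) ×
          (∀ {i j} → From k l i j → i ∉ S → j ∉ S → f (toℕ i) ≢ f (toℕ j) → var h′ $ans ≡ 1)
        finish : ∀ h′ → (∀ {i j} → From 0 0 i j → i ∉ S → j ∉ S → f (toℕ i) ≢ f (toℕ j) →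
                   var h′ $ans ≡ 1) →
                 IsCutset G S → var h′ $ans ≡ 1
        -- Being a cutset is a negation: if `$ans` is not 1, all labels outside `S` agree, and
        -- soundness would make G - S connected.
        finish h′ r cut with var h′ $ans ≟ 1
        ... | yes e = e
        ... | no ne = contradiction (λ {i} {j} i∉ j∉ → sound lab i∉ j∉ (same-label i∉ j∉)) cut
          where
          same-label : ∀ {i j} → i ∉ S → j ∉ S → f (toℕ i) ≡ f (toℕ j)
          same-label {i} {j} i∉ j∉ with f (toℕ i) ≟ f (toℕ j)
          ... | yes e  = e
          ... | no ne′ = contradiction (r from-all i∉ j∉ ne′) ne
        step : ∀ k l h′ → k < n → l < n → Frame compareLabels h h′ → var h′ $u ≡ k → var h′ $w ≡ l →
               I k (suc l) h′ → WP comparePair h′ (I k l)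
        step k l h′ k<n l<n φ ek el (p , q , r) with index k<n | index l<n
        ... | u , refl | w , refl =
          wp-outside (trans (φ (array W) refl) eW) u ek refl
            (λ u∈ → p , q , ignore λ u∉ _ _ → u∉ u∈)
            (λ u∉ → wp-outside (trans (φ (array W) refl) eW) w el refl
              (λ w∈ → p , q , ignore λ _ w∉ _ → w∉ w∈)
              (λ w∉ → wp-seq (wp-get (subst (_≤ N) (sym ek) (<n⇒≤N k<n))
                (wp-seq (wp-get (subst (_≤ N) (sym el) (<n⇒≤N l<n)) (wp-seq (wp-distance refl refl
                  (subst (_≤ N) (sym eu) (bounded lab _ k<n))
                  (subst (_≤ N) (sym ew) (bounded lab _ l<n))
                  λ h″ φ″ _ to from → wp-when
                    (λ d≡0 → let e = φ″ (variable′ $ans) refl in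
                      (λ x → trans e (p x)) , (λ x → q (trans (sym e) x)) ,
                      λ d i∉ j∉ ne → trans e
                        (ignore (λ _ _ ne → ne (trans (sym eu) (trans (to d≡0) ew))) d i∉ j∉ ne))
                    -- A path between `u` and `w` in G - S would force equal labels, as every
                    -- adjacent pair has been merged.
                    (λ d≢0 → wp-const ((λ _ → refl) ,
                      (λ _ → inj₂ λ conn → d≢0 (from (trans eu (trans
                        (connected-labels {f} (complete lab from-all) (conn u∉ w∉)) (sym ew))))) ,
                      λ _ _ _ _ → refl)))))))))
          where
          eL : ∀ i → arr h′ L i ≡ f i
          eL i = cong (λ g → g i) (φ (array L) refl)
          eu : arr h′ L (var h′ $u) ≡ f (toℕ u)
          eu = trans (eL _) (cong f ek)
          ew : arr h′ L (var h′ $w) ≡ f (toℕ w)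
          ew = trans (eL _) (cong f el)
          ignore : (u ∉ S → w ∉ S → ¬ f (toℕ u) ≢ f (toℕ w)) →
                   ∀ {i j} → From (toℕ u) (toℕ w) i j → i ∉ S → j ∉ S →
                   f (toℕ i) ≢ f (toℕ j) → var h′ $ans ≡ 1
          ignore g d i∉ j∉ ne with from-split d
          ... | inj₁ d′ = r d′ i∉ j∉ ne
          ... | inj₂ (e , e′) with toℕ-injective e | toℕ-injective e′
          ...   | refl | refl = contradiction ne (g i∉ j∉)

      testLeaf-spec : ∀ {h} → arr h W ≡ c → WP testLeaf h (LeafVerdict h)
      testLeaf-spec eW = initLabels-spec »» λ h₁ φ₁ init →
        mergeLabels-spec (trans (φ₁ (array W) refl) eW) init »» λ h₂ φ₂ lab →
        wp-weaken (λ h₃ _ (p , q , r) →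
          let e = ans-kept φ₁ φ₂ in (λ x → p (trans e x)) , (λ x → map₁ (trans (sym e)) (q x)) , r)
        (compareLabels-spec (trans (φ₂ (array W) refl) (trans (φ₁ (array W) refl) eW)) lab)
        where
        ans-kept : ∀ {h h₁ h₂} → Frame initLabels h h₁ → Frame mergeLabels h₁ h₂ →
                   var h₂ $ans ≡ var h $ans
        ans-kept φ₁ φ₂ = trans (φ₂ (variable′ $ans) refl) (φ₁ (variable′ $ans) refl)

-- The search tree

-- Contrapositively, connectedness of G - S′ gives that of G - S: each end lying in S′ is moved
-- along one edge to a vertex outside S′, and the new ends are joined in G - S′.
cutset-superset : ∀ {n} (G : Graph n) {S S′} → Connected G → IsIndependent G S′ → S ⊆ S′ →
                  IsCutset G S → IsCutset G S′
cutset-superset G {S} {S′} conn indep S⊆S′ cut conn′ = cut joined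
  where
  -- The neighbour of `u` is the first step of a walk to `v`, which is where `u ≢ v` is used.
  escape : ∀ {u v} → u ∉ S → u ≢ v → ∃ λ u′ → u′ ∉ S′ × Star (AdjAvoiding G S) u u′
  escape {u} {v} u∉ u≢v with u ∈? S′ | conn u v
  ... | no u∉′  | _      = u , u∉′ , ε
  ... | yes u∈′ | ε      = contradiction refl u≢v
  ... | yes u∈′ | a ◅ as = _ , u′∉ , (u∉ , u′∉ ∘ S⊆S′ , a) ◅ ε
    where u′∉ = λ u′∈ → indep u∈′ u′∈ a
  joined : ConnectedAvoiding G S
  joined {u} {v} u∉ v∉ with u Fin.≟ v
  ... | yes refl = ε
  ... | no u≢v with escape u∉ u≢v | escape v∉ (u≢v ∘ sym)
  ...   | u′ , u′∉ , p | v′ , v′∉ , q =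
    p ◅◅ Star.map (λ (x∉ , y∉ , a) → x∉ ∘ S⊆S′ , y∉ ∘ S⊆S′ , a) (conn′ u′∉ v′∉)
      ◅◅ Star.reverse (λ (x∉ , y∉ , a) → y∉ , x∉ , Graph.sym G a) q

-- Equality holds at 3. From there on the cube grows by a factor of at most 64/27 < 3; from 1 to 2
-- and from 2 to 3 it grows by more than 3, so the small cases stand apart from the induction.
k³≤3^k : ∀ k → k ^ 3 ≤ 3 ^ k
k³≤3^k 0 = z≤n
k³≤3^k 1 = s≤s z≤n
k³≤3^k 2 = m≤m+n 8 1
k³≤3^k (suc (suc (suc k))) = from-3 k
  where
  open ≤-Reasoning
  excess : ∀ k → 3 * ((3 + k) * ((3 + k) * ((3 + k) * 1))) ≡
           (4 + k) * ((4 + k) * ((4 + k) * 1)) + (2 * (k * (k * k)) + 15 * (k * k) + 33 * k + 17)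
  excess = solve-∀
  from-3 : ∀ k → (3 + k) ^ 3 ≤ 3 ^ (3 + k)
  from-3 zero    = ≤-refl
  from-3 (suc k) = begin
    (4 + k) ^ 3        ≤⟨ m≤m+n _ _ ⟩
    _                  ≡⟨ excess k ⟨
    3 * (3 + k) ^ 3    ≤⟨ *-monoʳ-≤ 3 (from-3 k) ⟩
    3 ^ (4 + k)        ∎

cube-* : ∀ a b → (a * b) ^ 3 ≡ a ^ 3 * b ^ 3
cube-* = expanded
  where
  expanded : ∀ a b → (a * b) * ((a * b) * ((a * b) * 1)) ≡ (a * (a * (a * 1))) * (b * (b * (b * 1)))
  expanded = solve-∀

-- Progress, validity and completeness of branching

module Exploration
  (n N : ℕ) (n≤N : n ≤ N) (G : Graph n) (connected : Connected G) (A : ℕ → ℕ → ℕ)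
  (A≢0⇒adj : ∀ i j → A (toℕ i) (toℕ j) ≢ 0 → Adj G i j)
  (adj⇒A≢0 : ∀ i j → Adj G i j → A (toℕ i) (toℕ j) ≢ 0) where

  open LeafTest n N n≤N G A A≢0⇒adj adj⇒A≢0 public

  child-self : ∀ c z → child c z z ≡ 1
  child-self c z = cong (if_then 1 else mark (c z) (A z z)) (dec-true (z ≟ z) refl)

  child-other : ∀ c {z w} → w ≢ z → child c z w ≡ mark (c w) (A z w)
  child-other c {z} {w} ne = cong (if_then 1 else mark (c w) (A z w)) (dec-false (w ≟ z) ne)

  mark≡1 : ∀ x {a} → mark x a ≡ 1 → x ≡ 1
  mark≡1 zero    {zero}  ()
  mark≡1 zero    {suc _} ()
  mark≡1 (suc x) e = e

  mark≡0 : ∀ x {a} → mark x a ≡ 0 → x ≡ 0 × a ≡ 0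
  mark≡0 zero {zero} _ = refl , refl

  mark≤1 : ∀ {x a} → x ≤ 1 → (x ≡ 0 → a ≡ 0) → mark x a ≤ 1
  mark≤1 {zero}          _   f rewrite f refl = z≤n
  mark≤1 {suc x} x≤1 _ = x≤1

  child≡1 : ∀ c {z w} → child c z w ≡ 1 → w ≡ z ⊎ c w ≡ 1
  child≡1 c {z} {w} e with w ≟ z
  ... | yes p = inj₁ p
  ... | no ¬p = inj₂ (mark≡1 (c w) (trans (sym (child-other c ¬p)) e))

  child≡0 : ∀ c {z w} → child c z w ≡ 0 → c w ≡ 0 × A z w ≡ 0
  child≡0 c {z} {w} e with w ≟ z
  ... | yes refl = contradiction (trans (sym e) (child-self c z)) λ ()
  ... | no ¬p    = mark≡0 (c w) (trans (sym (child-other c ¬p)) e)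

  -- Each undecided vertex is exactly one of three: still undecided in the child, a neighbour of
  -- `z`, or `z` itself. A loop at `z` would count `z` twice, so irreflexivity enters.
  remaining-child : ∀ c {z} → z < n → c z ≡ 0 →
                    remaining (child c z) + suc (degree c z) ≡ remaining c
  remaining-child c {z} z<n cz = begin
    remaining (child c z) + suc (degree c z)
      ≡⟨ cong (remaining (child c z) +_)
           (trans (+-comm 1 _) (cong (degree c z +_) (sym (Σ<-point n z<n)))) ⟩
    remaining (child c z) + (degree c z + Σ< n (point z))
      ≡⟨ cong (remaining (child c z) +_) (Σ<-+ n (neighbour c z) (point z)) ⟨
    remaining (child c z) + Σ< n (λ w → neighbour c z w + point z w)
      ≡⟨ Σ<-+ n (λ w → isZero (child c z w)) _ ⟨
    Σ< n (λ w → isZero (child c z w) + (neighbour c z w + point z w))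
      ≡⟨ Σ<-cong n pointwise ⟩
    remaining c ∎
    where
    open ≡-Reasoning
    loopless : A z z ≡ 0
    loopless with index z<n
    ... | i , refl with A (toℕ i) (toℕ i) ≟ 0
    ...   | yes e = e
    ...   | no ne = contradiction (A≢0⇒adj i i ne) (Graph.irrefl G refl)
    split : ∀ x a → isZero (mark x a) + (guard a (isZero x) + 0) ≡ isZero x
    split zero    zero    = refl
    split zero    (suc _) = refl
    split (suc _) zero    = refl
    split (suc _) (suc _) = refl
    pointwise : ∀ w → w < n → isZero (child c z w) + (neighbour c z w + point z w) ≡ isZero (c w)
    pointwise w w<n with w ≟ z
    ... | yes refl rewrite child-self c z | loopless | cz | dec-true (z ≟ z) refl = refl
    ... | no ne rewrite child-other c ne | dec-false (w ≟ z) ne = split (c w) (A z w)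

  -- `separated` is what makes every undecided vertex safe to choose, so that independence survives
  -- branching.
  record Valid (c : Config) : Set where
    field
      independent : IsIndependent G (chosen c)
      separated   : ∀ {i j} → c (toℕ i) ≡ 1 → c (toℕ j) ≡ 0 → ¬ Adj G i j
  open Valid

  -- Popping determines the array `W` only below `n`, so the configuration found there cannot be
  -- identified with the one pushed.
  Agree : Config → Config → Set
  Agree c′ c = ∀ i → i < n → c′ i ≡ c i

  valid-root : Valid (λ _ → 0)
  valid-root = record
    { independent = λ u∈ → contradiction (chosen⁻ (λ _ → 0) u∈) λ ()
    ; separated   = λ () }

  valid-agree : ∀ {c c′} → Agree c′ c → Valid c → Valid c′
  valid-agree {c} {c′} e v = record
    { independent = λ u∈ v∈ → independent v (move u∈) (move v∈)
    ; separated   = λ p q → separated v (trans (sym (at _)) p) (trans (sym (at _)) q) }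
    where
    at : ∀ i → c′ (toℕ i) ≡ c (toℕ i)
    at i = e (toℕ i) (toℕ<n i)
    move : ∀ {i} → i ∈ chosen c′ → i ∈ chosen c
    move i∈ = chosen⁺ c (trans (sym (at _)) (chosen⁻ c′ i∈))

  valid-child : ∀ {c z} → z < n → c z ≡ 0 → Valid c → Valid (child c z)
  valid-child {c} {z} z<n cz v with index z<n
  ... | k , refl = record { independent = λ {i} {j} → indep {i} {j} ; separated = sep }
    where
    indep : IsIndependent G (chosen (child c z))
    indep {i} {j} i∈ j∈ a
      with child≡1 c (chosen⁻ (child c z) i∈) | child≡1 c (chosen⁻ (child c z) j∈)
    ... | inj₁ p | inj₁ q = Graph.irrefl G (toℕ-injective (trans p (sym q))) a
    ... | inj₁ p | inj₂ q = separated v q (trans (cong c p) cz) (Graph.sym G a)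
    ... | inj₂ p | inj₁ q = separated v p (trans (cong c q) cz) a
    ... | inj₂ p | inj₂ q = independent v (chosen⁺ c p) (chosen⁺ c q) a
    sep : ∀ {i j} → child c z (toℕ i) ≡ 1 → child c z (toℕ j) ≡ 0 → ¬ Adj G i j
    sep {i} {j} p q a with child≡1 c p | child≡0 c {z} q
    ... | inj₁ e  | _  , az = adj⇒A≢0 k j (subst (λ k → Adj G k j) (toℕ-injective e) a) az
    ... | inj₂ ci | cj , _  = separated v ci cj a

  Compatible : Config → Subset n → Set
  Compatible c M = ∀ {i} → i ∈ M → c (toℕ i) ≤ 1

  compatible-child : ∀ {c M z} → (∀ {i} → i ∈ M → c (toℕ i) ≡ 0 → A z (toℕ i) ≡ 0) →
                     Compatible c M → Compatible (child c z) M
  compatible-child {c} {M} {z} f comp {i} i∈ with toℕ i ≟ z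
  ... | yes refl = ≤-reflexive (child-self c z)
  ... | no ne    = subst (_≤ 1) (sym (child-other c ne)) (mark≤1 (comp i∈) (f i∈))

  -- The invariant asks only that `M` avoid excluded vertices, not that it contain the chosen ones.
  -- Hence `v` may be chosen even outside `M`, provided that no undecided neighbour of `v` lies in
  -- `M`.
  compatible-branch : ∀ {c v zs M} → v < n → Branching c v zs → IsIndependent G M → Compatible c M →
                      ∃ λ z → z List.∈ zs × Compatible (child c z) M
  compatible-branch {c} {v} {zs} {M} v<n br indep comp with index v<n
  ... | k , refl with any? (λ i → (i ∈? M) ×-dec adj? G k i ×-dec (c (toℕ i) ≟ 0))
  ...   | yes (i , i∈ , a , ci) =
    toℕ i , Branching.all br (toℕ i) (toℕ<n i) (adj⇒A≢0 k i a) ci ,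
    compatible-child {c}
      (λ {j} j∈ _ → decidable-stable (_ ≟ 0) λ ne → indep i∈ j∈ (A≢0⇒adj i j ne)) comp
  ...   | no none =
    toℕ k , Branching.self br ,
    compatible-child {c}
      (λ {j} j∈ cj → decidable-stable (_ ≟ 0) λ ne → none (j , j∈ , A≢0⇒adj k j ne , cj)) comp

  compatible-leaf : ∀ {c M} → (∀ i → i < n → c i ≢ 0) → Compatible c M → M ⊆ chosen c
  compatible-leaf {c} c≢0 comp {i} i∈ =
    chosen⁺ c (≤-antisym (comp i∈) (n≢0⇒n>0 (c≢0 (toℕ i) (toℕ<n i))))

  data Processed (c : Config) (h h′ : Store) (rest : List ℕ) (κ : ℕ) : Set where
    leaf : (c≢0 : ∀ i → i < n → c i ≢ 0) → LeafVerdict c c≢0 h h′ →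
           stk h′ ≡ rest → var h′ $cnt ≡ κ → Processed c h h′ rest κ
    node : ∀ {v zs} → MinDegree c v → Branching c v zs → var h′ $ans ≡ var h $ans →
           stk h′ ≡ children c zs rest → var h′ $cnt ≡ length zs + κ → Processed c h h′ rest κ

  processConfig-spec : ∀ {h c rest κ} → stk h ≡ seg c 0 n rest → var h $cnt ≡ suc κ →
    WP processConfig h λ h′ → ∃ λ c′ → Agree c′ c × Processed c′ h h′ rest κ
  processConfig-spec {h} {c} {rest} {κ} es ec =
    wp-seq (wp-prec (popConfig-spec es »» λ h₁ φ₁ (s₁ , agree) →
      selectVertex-spec »» λ h₂ φ₂ sel →
        wp-branch (at-leaf φ₁ s₁ agree φ₂ sel) (at-node φ₁ s₁ agree φ₂ sel)))
    where
    Post : Store → Set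
    Post h′ = ∃ λ c′ → Agree c′ c × Processed c′ h h′ rest κ
    module _ {h₁ h₂ : Store} (φ₁ : Frame popConfig (setVar h $cnt (pred (var h $cnt))) h₁)
             (s₁ : stk h₁ ≡ rest) (agree : Agree (arr h₁ W) c) (φ₂ : Frame selectVertex h₁ h₂) where
      Selection : Set
      Selection = (var h₂ $found ≡ 0 × (∀ u → u < n → arr h₁ W u ≢ 0)) ⊎
                  (var h₂ $found ≢ 0 × MinDegree (arr h₁ W) (var h₂ $v))
      cnt₂ : var h₂ $cnt ≡ κ
      cnt₂ = trans (φ₂ (variable′ $cnt) refl) (trans (φ₁ (variable′ $cnt) refl) (cong pred ec))
      ans₂ : var h₂ $ans ≡ var h $ans
      ans₂ = trans (φ₂ (variable′ $ans) refl) (φ₁ (variable′ $ans) refl)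
      W₂ : arr h₂ W ≡ arr h₁ W
      W₂ = φ₂ (array W) refl
      s₂ : stk h₂ ≡ rest
      s₂ = trans (φ₂ stack refl) s₁
      at-leaf : Selection → var h₂ $found ≡ 0 → WP testLeaf h₂ Post
      at-leaf (inj₂ (f≢0 , _)) f≡0 = contradiction f≡0 f≢0
      at-leaf (inj₁ (_ , c≢0)) _   = wp-weaken
        (λ h₃ φ₃ (p , q , r) → arr h₁ W , agree , leaf c≢0
          ((λ x → p (trans ans₂ x)) , (λ x → map₁ (trans (sym ans₂)) (q x)) , r)
          (trans (φ₃ stack refl) s₂) (trans (φ₃ (variable′ $cnt) refl) cnt₂))
        (testLeaf-spec (arr h₁ W) c≢0 W₂)
      at-node : Selection → var h₂ $found ≢ 0 → WP pushChildren h₂ Post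
      at-node (inj₁ (f≡0 , _)) f≢0 = contradiction f≡0 f≢0
      at-node (inj₂ (_ , min)) _   = wp-weaken
        (λ h₃ φ₃ (zs , br , es′ , ec′) →
          arr h₂ W , (λ i i<n → trans (cong (λ g → g i) W₂) (agree i i<n)) ,
          node min₂ br (trans (φ₃ (variable′ $ans) refl) ans₂)
            (trans es′ (cong (children (arr h₂ W) zs) s₂)) (trans ec′ (cong (length zs +_) cnt₂)))
        (pushChildren-spec min₂)
        where
        min₂ : MinDegree (arr h₂ W) (var h₂ $v)
        min₂ = subst (λ g → MinDegree g (var h₂ $v)) (sym W₂) min

  -- Passes through the search loop and leaves of the search tree

  record Step (body : Program) (bound : ℕ) (c : Config) (s : State) (h : Store)
              (rest : List ℕ) (κ : ℕ) : Set where
    constructor step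
    field
      {s′}      : State
      {time}    : ℕ
      exec      : body ⊢ s ⇓ s′ after time
      time≤     : time ≤ bound
      h′        : Store
      sim       : Sim h′ s′
      processed : ∃ λ c′ → Agree c′ c × Processed c′ h h′ rest κ

  -- The count depends only on the effect of one pass and a bound for its time, so the body is a
  -- parameter.
  module Loop (body : Program) (bound : ℕ)
    (body-step : ∀ {c rest κ s h} → Sim h s → stk h ≡ seg c 0 n rest → var h $cnt ≡ suc κ →
                 Step body bound c s h rest κ) where

    search : Program
    search = whileNonZero ⌜ $cnt ⌝ loop body

    iteration : ℕ
    iteration = suc bound

    -- The loop leads from s to s′ in at most k iterations: every run from s′ can be
    -- prolonged to one from s.
    record Reaches (s s′ : State) (k : ℕ) : Set where
      constructor reaching
      field
        continue : ∀ {s″ t} → search ⊢ s′ ⇓ s″ after t →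
                   ∃ λ t′ → (search ⊢ s ⇓ s″ after t′) × t′ ≤ k * iteration + t
    open Reaches

    reaches-refl : ∀ {s} → Reaches s s 0
    reaches-refl = reaching λ e → _ , e , ≤-refl

    reaches-trans : ∀ {s s′ s″ k k′} → Reaches s s′ k → Reaches s′ s″ k′ → Reaches s s″ (k + k′)
    reaches-trans {k = k} {k′} f g = reaching λ {_} {t₀} e →
      let t  , e′ , p  = continue g e
          t′ , e″ , p′ = continue f e′
      in t′ , e″ , (begin
        t′                                       ≤⟨ p′ ⟩
        k * iteration + t                        ≤⟨ +-monoʳ-≤ (k * iteration) p ⟩
        k * iteration + (k′ * iteration + t₀)    ≡⟨ +-assoc (k * iteration) _ _ ⟨
        k * iteration + k′ * iteration + t₀      ≡⟨ cong (_+ t₀) (*-distribʳ-+ iteration k k′) ⟨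
        (k + k′) * iteration + t₀                ∎)
      where open ≤-Reasoning

    reaches-step : ∀ {s s′ t} → reg s ⌜ $cnt ⌝ ≢ 0 → body ⊢ s ⇓ s′ after t →
                   t ≤ bound → Reaches s s′ 1
    reaches-step ne e p = reaching λ {_} {t₀} e′ → _ , while-step ne e e′ ,
      ≤-trans (s≤s (+-monoˡ-≤ t₀ p)) (≤-reflexive (cong (_+ t₀) (sym (*-identityˡ iteration))))

    -- b bounds the number of leaves of each search tree that is explored.
    record Explored (s : State) (h : Store) (rest : List ℕ) (κ : ℕ)
                    (Covers : Subset n → Set) (iterations : ℕ → ℕ) (e : ℕ) : Set where
      field
        {s′}       : State
        {h′}       : Store
        {k b}      : ℕ
        sim        : Sim h′ s′
        stk≡       : stk h′ ≡ rest
        cnt≡       : var h′ $cnt ≡ κ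
        reaches    : Reaches s s′ k
        k≤         : k ≤ iterations b
        b≥1        : 1 ≤ b
        b³≤        : b ^ 3 ≤ 3 ^ e
        kept       : var h $ans ≡ 1 → var h′ $ans ≡ 1
        correct    : var h′ $ans ≡ 1 → var h $ans ≡ 1 ⊎ HasIndependentCutset G
        complete   : ∀ M → IsIndependent G M → IsCutset G M → Covers M → var h′ $ans ≡ 1

    -- `m` is at once the recursion measure and the number of passes allowed per leaf: every node
    -- lies on a path of at most `m` nodes from the root to a leaf.
    explore : ∀ m c {rest κ s h} → remaining c < m → Valid c → Sim h s →
              stk h ≡ seg c 0 n rest → var h $cnt ≡ suc κ →
              Explored s h rest κ (Compatible c) (m *_) (remaining c)
    -- Siblings share one leaf bound, the maximum of theirs, and one bound `e` on the undecided
    -- vertices. The parent then has at most `length zs * b` leaves, which is the form the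
    -- recurrence needs.
    exploreAll : ∀ m c zs e {rest κ s h} →
                 All (λ z → z < n × c z ≡ 0) zs →
                 All (λ z → remaining (child c z) < m × remaining (child c z) ≤ e) zs →
                 Valid c → Sim h s →
                 stk h ≡ children c zs rest → var h $cnt ≡ length zs + κ →
                 Explored s h rest κ (λ M → ∃ λ z → z List.∈ zs × Compatible (child c z) M)
                          (λ b → length zs * (m * b)) e

    explore (suc m) c {rest} {κ} {s} {h} r<m valid σ es ec with body-step σ es ec
    ... | step {s₁} exec t≤ h₁ σ₁ (c′ , agree , post) = go post
      where
      first : Reaches s s₁ 1
      first = reaches-step
        (λ e → 1+n≢0 (trans (sym ec) (trans (sym (Sim.variables σ $cnt)) e))) exec t≤
      valid′ : Valid c′
      valid′ = valid-agree agree valid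
      independent′ : IsIndependent G (chosen c′)
      independent′ {u} {v} = independent valid′ {u} {v}
      compatible′ : ∀ {M} → Compatible c M → Compatible c′ M
      compatible′ comp {i} i∈ = subst (_≤ 1) (sym (agree (toℕ i) (toℕ<n i))) (comp i∈)
      remaining′ : remaining c′ ≡ remaining c
      remaining′ = Σ<-cong n λ i i<n → cong isZero (agree i i<n)
      go : Processed c′ h h₁ rest κ → Explored s h rest κ (Compatible c) (suc m *_) (remaining c)
      go (leaf c≢0 (p , q , r) es′ ec′) = record
        { sim = σ₁ ; stk≡ = es′ ; cnt≡ = ec′ ; reaches = first
        ; k≤ = s≤s z≤n ; b≥1 = ≤-refl ; b³≤ = m^n>0 3 (remaining c)
        ; kept = p
        ; correct = λ x → [ inj₁ , (λ cut → inj₂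
            (chosen c′ , cut , λ {u} {v} → independent′ {u} {v})) ]′ (q x)
        ; complete = λ M indep cut comp → r (cutset-superset G connected
            (λ {u} {v} → independent′ {u} {v}) (compatible-leaf {c′} c≢0 (compatible′ comp)) cut)
        }
      go (node {v} {zs} (v<n , cv , min) br ea es′ ec′) = record
        { sim = sim ; stk≡ = stk≡ ; cnt≡ = cnt≡
        ; reaches = reaches-trans first reaches
        -- The pass for the node itself is charged to its leaves, of which there is at least one: 1
        -- + m · ℓ ≤ (1 + m) · ℓ.
        ; k≤ = ≤-trans (s≤s k≤) (begin
            1 + length zs * (m * b)             ≤⟨ +-monoˡ-≤ _ ℓ≥1 ⟩
            ℓ + length zs * (m * b)             ≡⟨ cong (ℓ +_) (rearrange (length zs) m b) ⟩
            suc m * ℓ                           ∎)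
        ; b≥1 = ℓ≥1
        ; b³≤ = begin
            ℓ ^ 3                               ≡⟨ cube-* (length zs) b ⟩
            length zs ^ 3 * b ^ 3               ≤⟨ *-mono-≤ (k³≤3^k (length zs)) b³≤ ⟩
            3 ^ length zs * 3 ^ e               ≡⟨ ^-distribˡ-+-* 3 (length zs) e ⟨
            3 ^ (length zs + e)                 ≡⟨ cong (λ l → 3 ^ (l + e)) length≡ ⟩
            3 ^ (suc (degree c′ v) + e)         ≡⟨ cong (3 ^_) (m+[n∸m]≡n enough) ⟩
            3 ^ remaining c                     ∎
        ; kept = λ x → kept (trans ea x)
        ; correct = λ x → map₁ (trans (sym ea)) (correct x)
        ; complete = λ M indep cut comp → complete M indep cut
            (compatible-branch v<n br indep (compatible′ comp))
        }
        where
        open ≤-Reasoning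
        open Branching br
        -- The number of vertices left if only the closed neighbourhood of `v` were decided.
        e = remaining c ∸ suc (degree c′ v)
        removed : ∀ {z} → z < n × c′ z ≡ 0 →
                  remaining (child c′ z) + suc (degree c′ z) ≡ remaining c
        removed (z<n , cz) = trans (remaining-child c′ z<n cz) remaining′
        enough : suc (degree c′ v) ≤ remaining c
        enough = subst (suc (degree c′ v) ≤_) (removed (v<n , cv)) (m≤n+m _ _)
        -- Minimality of the degree of `v` enters here: choosing `z` decides at least as many
        -- vertices as choosing `v` would.
        smaller : ∀ {z} → z < n × c′ z ≡ 0 → remaining (child c′ z) < m × remaining (child c′ z) ≤ e
        smaller {z} p@(z<n , cz) =
          ≤-trans (subst (suc r ≤_) (removed p) (m<m+n r (s≤s z≤n))) (≤-pred r<m) ,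
          m+n≤o⇒m≤o∸n r (subst (r + suc (degree c′ v) ≤_) (removed p)
            (+-monoʳ-≤ r (s≤s (min z z<n cz))))
          where r = remaining (child c′ z)
        open Explored (exploreAll m c′ zs e free (All.map smaller free) valid′ σ₁ es′ ec′)
        ℓ = length zs * b
        ℓ≥1 : 1 ≤ ℓ
        ℓ≥1 = *-mono-≤ (subst (1 ≤_) (sym length≡) (s≤s z≤n)) b≥1
        rearrange : ∀ x y z → x * (y * z) ≡ y * (x * z)
        rearrange = solve-∀

    exploreAll m c [] e _ _ valid σ es ec = record
      { sim = σ ; stk≡ = es ; cnt≡ = ec ; reaches = reaches-refl
      -- The maximum over siblings starts at 1, which is below the bound of any tree.
      ; k≤ = z≤n ; b≥1 = ≤-refl ; b³≤ = m^n>0 3 e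
      ; kept = id ; correct = inj₁ ; complete = λ { _ _ _ (_ , () , _) } }
    exploreAll m c (z ∷ zs) e ((z<n , cz) ∷ free) ((r<m , r≤e) ∷ small) valid σ es ec = record
      { sim = R.sim ; stk≡ = R.stk≡ ; cnt≡ = R.cnt≡
      ; reaches = reaches-trans F.reaches R.reaches
      ; k≤ = +-mono-≤ (≤-trans F.k≤ (*-monoʳ-≤ m (m≤m⊔n F.b R.b)))
          (≤-trans R.k≤ (*-monoʳ-≤ (length zs) (*-monoʳ-≤ m (m≤n⊔m F.b R.b))))
      ; b≥1 = ≤-trans F.b≥1 (m≤m⊔n F.b R.b)
      ; b³≤ = [ (λ p → subst (λ b → b ^ 3 ≤ 3 ^ e) (sym p) (≤-trans F.b³≤ (^-monoʳ-≤ 3 r≤e)))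
              , (λ p → subst (λ b → b ^ 3 ≤ 3 ^ e) (sym p) R.b³≤) ]′ (⊔-sel F.b R.b)
      ; kept = R.kept ∘ F.kept
      ; correct = λ x → [ F.correct , inj₂ ]′ (R.correct x)
      ; complete = λ { M indep cut (_ , here refl , comp) → R.kept (F.complete M indep cut comp)
                     ; M indep cut (z′ , there z∈ , comp) →
                         R.complete M indep cut (z′ , z∈ , comp) }
      }
      where
      module F = Explored (explore m (child c z) r<m (valid-child z<n cz valid) σ es ec)
      module R = Explored (exploreAll m c zs e free small valid F.sim F.stk≡ F.cnt≡)

-- The encoding

contents-++ˡ : ∀ xs {ys i} → i < length xs → contents (xs ++ ys) i ≡ contents xs i
contents-++ˡ (x ∷ xs) {i = zero}  _   = refl
contents-++ˡ (x ∷ xs) {i = suc i} i<l = contents-++ˡ xs (≤-pred i<l)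

contents-++ʳ : ∀ xs {ys i} → contents (xs ++ ys) (length xs + i) ≡ contents ys i
contents-++ʳ []       = refl
contents-++ʳ (x ∷ xs) = contents-++ʳ xs

contents-tabulate : ∀ {n} (f : Fin n → ℕ) i → contents (tabulate f) (toℕ i) ≡ f i
contents-tabulate f Fin.zero    = refl
contents-tabulate f (Fin.suc i) = contents-tabulate (f ∘ Fin.suc) i

contents-matrix : ∀ {m n} (f : Fin m → Fin n → ℕ) i j →
  contents (concat (tabulate λ u → tabulate (f u))) (toℕ i * n + toℕ j) ≡ f i j
contents-matrix {n = n} f Fin.zero j = trans
  (contents-++ˡ (tabulate (f Fin.zero))
    (subst (toℕ j <_) (sym (length-tabulate (f Fin.zero))) (toℕ<n j)))
  (contents-tabulate (f Fin.zero) j)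
contents-matrix {n = n} f (Fin.suc i) j = begin
  contents (row ++ rows) (n + toℕ i * n + toℕ j)
    ≡⟨ cong (contents (row ++ rows)) (+-assoc n _ _) ⟩
  contents (row ++ rows) (n + (toℕ i * n + toℕ j))
    ≡⟨ cong (λ l → contents (row ++ rows) (l + (toℕ i * n + toℕ j)))
            (length-tabulate (f Fin.zero)) ⟨
  contents (row ++ rows) (length row + (toℕ i * n + toℕ j))
    ≡⟨ contents-++ʳ row ⟩
  contents rows (toℕ i * n + toℕ j)
    ≡⟨ contents-matrix (f ∘ Fin.suc) i j ⟩
  f (Fin.suc i) j ∎
  where
  open ≡-Reasoning
  row = tabulate (f Fin.zero)
  rows = concat (tabulate λ u → tabulate (f (Fin.suc u)))

length-matrix : ∀ {m n} (f : Fin m → Fin n → ℕ) →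
  length (concat (tabulate λ u → tabulate (f u))) ≡ m * n
length-matrix {zero}  f = refl
length-matrix {suc m} f = trans (length-++ (tabulate (f Fin.zero)))
  (cong₂ _+_ (length-tabulate (f Fin.zero)) (length-matrix (f ∘ Fin.suc)))

-- Read off the encoding and not defined from `adj?`, so that it matches the initial memory
-- definitionally for all numeric arguments.
matrixEntry : ∀ {n} → Graph n → ℕ → ℕ → ℕ
matrixEntry {n} G u w = contents (encodeGraph G) (suc (u * n + w))

matrixEntry-toℕ : ∀ {n} (G : Graph n) i j →
  matrixEntry G (toℕ i) (toℕ j) ≡ (if does (adj? G i j) then 1 else 0)
matrixEntry-toℕ G = contents-matrix λ u v → if does (adj? G u v) then 1 else 0

matrixEntry≢0⇒adj : ∀ {n} (G : Graph n) i j → matrixEntry G (toℕ i) (toℕ j) ≢ 0 → Adj G i j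
matrixEntry≢0⇒adj G i j ne with adj? G i j | matrixEntry-toℕ G i j
... | yes a | _ = a
... | no _  | e = contradiction e ne

adj⇒matrixEntry≢0 : ∀ {n} (G : Graph n) i j → Adj G i j → matrixEntry G (toℕ i) (toℕ j) ≢ 0
adj⇒matrixEntry≢0 G i j a e with adj? G i j | matrixEntry-toℕ G i j
... | yes _ | e′ = 1+n≢0 (trans (sym e′) e)
... | no ¬a | _  = ¬a a

order≤size : ∀ {n} (G : Graph n) → n ≤ length (encodeGraph G)
order≤size {n} G = begin
  n              ≤⟨ square n ⟩
  n * n          ≤⟨ n≤1+n _ ⟩
  suc (n * n)
    ≡⟨ cong suc (length-matrix λ u v → if does (adj? G u v) then 1 else 0) ⟨
  length (encodeGraph G) ∎
  where
  open ≤-Reasoning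
  square : ∀ n → n ≤ n * n
  square zero    = z≤n
  square (suc n) = m≤m+n (suc n) _

-- The decision procedure and its running time

setup : Program
setup =
  -- All registers start at 0, so `Acc` addresses the vertex count. `Base` becomes 1 + n², the first
  -- address after the input, and `Top` becomes `Base` + 2, the bottom cell of the stack.
  Order ≔mem[ Acc ] ⨾ Acc ≔# 1 ⨾ addMultiple Order ⨾
  Base ≔ Acc ⨾ Top ≔suc Base ⨾ Top ≔suc Top

opaque

  rootCode bodyCode : Program
  rootCode = compile pushRoot
  bodyCode = compile processConfig

decide : Program
decide = setup ⨾ rootCode ⨾ (whileNonZero ⌜ $cnt ⌝ loop bodyCode) ⨾ 0 ≔ ⌜ $ans ⌝

-- The factor left after the number of leaves is split off. `suc N` covers the passes per leaf, and
-- the 2 covers the last test of the search loop and the copying of the answer.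
overhead : Program → Program → Program → ℕ → ℕ
overhead P Q R N = cost N P + (cost N Q + (suc N * suc (cost N R) + 2))

overhead-poly : ∀ P Q R → PolyBounded (overhead P Q R)
overhead-poly P Q R = poly-+ (cost-poly P) (poly-+ (cost-poly Q)
  (poly-+ (poly-* (poly-suc poly-id) (poly-suc (cost-poly R))) (poly-const 2)))

total-bound : ∀ {t t′ t″ a a′ b k l n N} → t ≤ a → t′ ≤ a′ → t″ ≤ k * b + 1 →
              k ≤ suc n * l → n ≤ N → 1 ≤ l →
              t + (t′ + (t″ + 1)) ≤ l * (a + (a′ + (suc N * b + 2)))
total-bound {t} {t′} {t″} {a} {a′} {b} {k} {l} {n} {N} p p′ p″ q r 1≤l = begin
  t + (t′ + (t″ + 1))                       ≤⟨ +-mono-≤ p (+-mono-≤ p′ (+-monoˡ-≤ 1 p″)) ⟩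
  a + (a′ + (k * b + 1 + 1))                ≡⟨ cong (λ x → a + (a′ + x)) (+-assoc (k * b) 1 1) ⟩
  a + (a′ + (k * b + 2))
    ≤⟨ +-mono-≤ (scale a) (+-mono-≤ (scale a′) (+-mono-≤ iterations (scale 2))) ⟩
  l * a + (l * a′ + (l * (suc N * b) + l * 2))  ≡⟨ collect l a a′ (suc N * b) 2 ⟨
  l * (a + (a′ + (suc N * b + 2)))          ∎
  where
  open ≤-Reasoning
  scale : ∀ x → x ≤ l * x
  -- There is at least one leaf, so the cost outside the loop may be multiplied by their number as
  -- well.
  scale x = ≤-trans (≤-reflexive (sym (*-identityˡ x))) (*-monoˡ-≤ x 1≤l)
  swap : ∀ x y z → x * y * z ≡ y * (x * z)
  swap = solve-∀
  collect : ∀ l a b c d → l * (a + (b + (c + d))) ≡ l * a + (l * b + (l * c + l * d))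
  collect = solve-∀
  iterations : k * b ≤ l * (suc N * b)
  iterations = begin
    k * b              ≤⟨ *-monoˡ-≤ b q ⟩
    suc n * l * b      ≤⟨ *-monoˡ-≤ b (*-monoˡ-≤ l (s≤s r)) ⟩
    suc N * l * b      ≡⟨ swap (suc N) l b ⟩
    l * (suc N * b)    ∎

module Decision {n} (G : Graph n) (connected : Connected G) (N : ℕ) (n≤N : n ≤ N) where

  open Exploration n N n≤N G connected (matrixEntry G) (matrixEntry≢0⇒adj G) (adj⇒matrixEntry≢0 G)

  memory : ℕ → ℕ
  memory = contents (encodeGraph G)

  start : Store
  start = store (λ _ → 0) (λ k i → memory (cell (offset k) i)) []

  run-setup : Run setup (initial (encodeGraph G)) (Sim start)
  run-setup = chain (run-load (chain (run-const (run-addMultiple Order refl n≤N >>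
    λ { {s′} (same f refl , e) → chain (run-copy (chain (run-suc (run-suc record
      { variables = λ x → f (3 + x)
      ; nr = f 0
      ; br = e
      ; sp = trans (cong (2 +_) e) (+-comm 2 base)
      ; entries = λ _ _ → refl
      ; arrays = λ _ _ → refl
      ; stored = tt }))))}))))

  wp⇒step : ∀ {d c rest κ s h} → WP d h (λ h′ → ∃ λ c′ → Agree c′ c × Processed c′ h h′ rest κ) →
            Sim h s → Step (compile d) (cost N (compile d)) c s h rest κ
  wp⇒step p σ with sound p σ
  ... | ran exec time≤ (h′ , σ′ , _ , q) = step exec time≤ h′ σ′ q

  opaque
    unfolding rootCode bodyCode

    run-root : ∀ {s} → Sim start s → Run rootCode s λ s′ → ∃ λ h′ → Sim h′ s′ ×
      stk h′ ≡ seg (λ _ → 0) 0 n [] × var h′ $cnt ≡ 1 × var h′ $ans ≡ 0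
    run-root σ = weaken (λ (h′ , σ′ , _ , p) → h′ , σ′ , p) (sound (pushRoot-spec refl) σ)

    body-step : ∀ {c rest κ s h} → Sim h s → stk h ≡ seg c 0 n rest → var h $cnt ≡ suc κ →
      Step bodyCode (cost N bodyCode) c s h rest κ
    body-step σ es ec = wp⇒step (processConfig-spec es ec) σ

  open Loop bodyCode (cost N bodyCode) body-step

  decides : ∃₂ λ s t → decide ⊢ initial (encodeGraph G) ⇓ s after t ×
    (Accepting s ⇔ HasIndependentCutset G) ×
    ∃ λ b → b ^ 3 ≤ 3 ^ n × t ≤ b * overhead setup rootCode bodyCode N
  decides with run-setup
  ... | ran exec₁ t₁≤ σ₁ with run-root σ₁
  ...   | ran exec₂ t₂≤ (h₂ , σ₂ , es , ec , ea) =
    _ , _ , seq exec₁ (seq exec₂ (seq (proj₁ (proj₂ searched)) copy)) ,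
    mk⇔ (λ x → [ (λ y → contradiction (trans (sym ea) y) λ ()) , id ]′
                 (correct (trans (sym (Sim.variables sim $ans)) x)))
        (λ (M , cut , indep) → trans (Sim.variables sim $ans) (complete M indep cut λ _ → z≤n)) ,
    b , subst (λ r → b ^ 3 ≤ 3 ^ r) (Σ<-ones n) b³≤ ,
    total-bound t₁≤ t₂≤ (proj₂ (proj₂ searched)) k≤ n≤N b≥1
    where
    open Explored (explore (suc n) (λ _ → 0) (s≤s (≤-reflexive (Σ<-ones n))) valid-root σ₂ es ec)
    searched = Reaches.continue reaches (while-stop (trans (Sim.variables sim $cnt) cnt≡))

corollary3p3 : INDEPENDENT-CUTSET SolvableInO*[ 3 ^ order / 3 ]
corollary3p3 = decide , coefficient , exponent , λ I →
  let s , t , exec , correct , b , b³≤ , t≤ =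
        Decision.decides (graph I) (ConnectedGraph.connected I)
          -- This choice of `N` is positive, bounds the number of vertices, and is the base of the
          -- polynomial factor in the time bound.
          (suc (length (encodeGraph (graph I)))) (m≤n⇒m≤1+n (order≤size (graph I)))
      N = suc (length (encodeGraph (graph I)))
      open ≤-Reasoning
  in s , t , exec , correct , (begin
    t ^ 3
      ≤⟨ ^-monoˡ-≤ 3 (≤-trans t≤ (*-monoʳ-≤ b (bound _))) ⟩
    (b * (coefficient * N ^ exponent)) ^ 3            ≡⟨ cube-* b _ ⟩
    b ^ 3 * (coefficient * N ^ exponent) ^ 3          ≤⟨ *-monoˡ-≤ _ b³≤ ⟩
    3 ^ order I * (coefficient * N ^ exponent) ^ 3    ∎)
  where
  open PolyBounded (overhead-poly setup rootCode bodyCode)
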